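{- Let $n\geq 3$ be an integer. Then for every $n$-vertex unicyclic graph $G$, $$n(US_n)\geq n(G)\geq n(UP_n).$$
   Context: A unicyclic graph is a connected graph containing exactly one cycle. A subtree of a graph $G$ is a subgraph of $G$ (a vertex set together with an edge set) that is a tree; two subtrees are different if they differ as subgraphs. $n(G)$ denotes the number of subtrees of $G$, where by convention the empty subtree is also counted (so there is exactly one subtree with $0$ vertices). $S_n$ is the $n$-vertex star and $P_n$ the $n$-vertex path. $US_n$ is the unicyclic graph obtained from $S_n$ by adding an edge joining two of its leaves. $UP_n$ is the unicyclic graph obtained by identifying a vertex of the triangle $C_3$ with an end vertex of $P_{n-2}$. -}

module Defs where

open import Data.Bool using (Bool; true; false)
open import Data.Empty using (⊥-elim)
open import Data.Fin using (Fin; toℕ) renaming (zero to fzero; suc to fsuc)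
import Data.Fin.Properties as Fin
open import Data.Fin.Subset using (Subset; _∈_; _∉_; _⊆_; ∣_∣; ⊤)
open import Data.Fin.Subset.Properties using (_∈?_; _⊆?_; ∈⊤)
open import Data.List using
  (List; []; _∷_; _∷ʳ_; length; lookup; zip; filter; cartesianProductWith; cartesianProduct; mapMaybe;
   upTo; allFin; concatMap)
  renaming (map to mapˡ)
import Data.List.Membership.DecPropositional as DecMembership
open import Data.List.Membership.Propositional using () renaming (_∈_ to _∈ˡ_)
open import Data.List.Membership.Propositional.Properties using
  (∈-cartesianProductWith⁺; ∈-cartesianProduct⁺; ∈-allFin; ∈-map⁺; ∈-concatMap⁺; ∈-upTo⁺; ∈-lookup)
open import Data.List.Membership.Propositional using (find; lose)
open import Data.List.Relation.Unary.All using (All; []; _∷_)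
import Data.List.Relation.Unary.All as All
import Data.List.Relation.Unary.All.Properties as All
open import Data.List.Relation.Unary.Any using (here; there; any?)
open import Data.List.Relation.Unary.AllPairs using ([]; _∷_)
open import Data.List.Relation.Unary.Unique.Propositional using (Unique)
import Data.List.Relation.Unary.Unique.Propositional.Properties as Unique
open import Data.List.Relation.Unary.Unique.DecPropositional using (unique?)
open import Data.Maybe using (Maybe; just; nothing)
open import Data.Nat using (ℕ; zero; suc; _≤_; _<_; s≤s) renaming (_≟_ to _≟ℕ_; _≤?_ to _≤ℕ?_; _<?_ to _<ℕ?_)
import Data.Nat.Properties as ℕ
open import Data.Product using (∃; ∃!; _×_; _,_; proj₁; proj₂)
import Data.Product.Properties as Product
open import Data.Sum using (_⊎_; inj₁; inj₂; swap; [_,_]′)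
open import Data.Vec using (Vec; []; _∷_; tabulate) renaming (lookup to lookupᵛ; toList to toListᵛ; fromList to fromListᵛ)
import Data.Vec.Properties as Vec
open import Function using (_∘_; case_of_)
open import Function.Bundles using (_⇔_; mk⇔; Equivalence)
open import Relation.Binary.Construct.Closure.ReflexiveTransitive using (Star; ε; _◅_)
open import Relation.Binary.PropositionalEquality using (_≡_; _≢_; refl; sym; trans; cong; subst)
open import Relation.Nullary using (Dec; yes; no; ¬_)
open import Relation.Nullary.Decidable using (map′; _×-dec_; _⊎-dec_; _→-dec_; recompute; does; dec-true)

private
  variable
    m n k : ℕ

record IsSimple (V : Subset m) (N : Vec (Subset m) m) : Set where
  constructor isSimple
  field
    endpoint    : ∀ u v → v ∈ lookupᵛ N u → u ∈ V
    symmetric   : ∀ u v → v ∈ lookupᵛ N u → u ∈ lookupᵛ N v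
    irreflexive : ∀ u → u ∉ lookupᵛ N u

-- The vertex set may be any subset of Fin m, so that a subgraph of a graph is
-- again a Graph m.  Vertex and edge sets are stored as Boolean tables and the
-- laws are irrelevant, so _≡_ on Graph m is equality of subgraphs.
record Graph (m : ℕ) : Set where
  constructor graph
  field
    vertices   : Subset m
    neighbours : Vec (Subset m) m
    .simple    : IsSimple vertices neighbours

  Adj : Fin m → Fin m → Set
  Adj u v = v ∈ lookupᵛ neighbours u

  order : ℕ
  order = ∣ vertices ∣

open Graph public

infix 4 _⊑_

_⊑_ : Graph m → Graph m → Set
H ⊑ G = vertices H ⊆ vertices G × (∀ u v → Adj H u v → Adj G u v)

-- The graph without vertices is Connected, hence a tree below.  This is the
-- convention that the empty subtree is counted, exactly once.
Connected : Graph m → Set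
Connected G = ∀ u v → u ∈ vertices G → v ∈ vertices G → Star (Adj G) u v

rotate : ∀ {a} {A : Set a} → List A → List A
rotate []       = []
rotate (x ∷ xs) = xs ∷ʳ x

CyclicallyConsecutive : List (Fin m) → Fin m → Fin m → Set
CyclicallyConsecutive xs u v =
  (u , v) ∈ˡ zip xs (rotate xs) ⊎ (v , u) ∈ˡ zip xs (rotate xs)

IsCycle : Graph m → Set
IsCycle C = ∃ λ xs →
  Unique xs × 3 ≤ length xs ×
  (∀ u → u ∈ vertices C ⇔ u ∈ˡ xs) ×
  (∀ u v → Adj C u v ⇔ CyclicallyConsecutive xs u v)

Acyclic : Graph m → Set
Acyclic G = ¬ ∃ λ C → C ⊑ G × IsCycle C

IsTree : Graph m → Set
IsTree G = Connected G × Acyclic G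

Unicyclic : Graph m → Set
Unicyclic G = Connected G × ∃! _≡_ λ C → C ⊑ G × IsCycle C

words : ∀ {a} {A : Set a} → List A → ∀ k → List (Vec A k)
words as zero    = [] ∷ []
words as (suc k) = cartesianProductWith _∷_ as (words as k)

∈-words : ∀ {a} {A : Set a} {as : List A} → (∀ x → x ∈ˡ as) → (w : Vec A k) → w ∈ˡ words as k
∈-words full []      = here refl
∈-words full (x ∷ w) = ∈-cartesianProductWith⁺ _∷_ (full x) (∈-words full w)

words-unique : ∀ {a} {A : Set a} {as : List A} → Unique as → ∀ k → Unique (words as k)
words-unique as! zero    = [] ∷ []
words-unique as! (suc k) =
  Unique.cartesianProductWith⁺ _∷_ Vec.∷-injective as! (words-unique as! k)

isSimple? : (V : Subset m) (N : Vec (Subset m) m) → Dec (IsSimple V N)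
isSimple? V N = map′ (λ (e , s , i) → isSimple e s i) (λ (isSimple e s i) → e , s , i)
  ((Fin.all? λ u → Fin.all? λ v → (v ∈? lookupᵛ N u) →-dec (u ∈? V)) ×-dec
   (Fin.all? λ u → Fin.all? λ v → (v ∈? lookupᵛ N u) →-dec (u ∈? lookupᵛ N v)) ×-dec
   (Fin.all? λ u → (u ∈? lookupᵛ N u) →-dec no λ ()))

simple! : (G : Graph m) → IsSimple (vertices G) (neighbours G)
simple! (graph V N s) = recompute (isSimple? V N) s

toGraph : Subset m × Vec (Subset m) m → Maybe (Graph m)
toGraph (V , N) = case isSimple? V N of λ where
  (yes s) → just (graph V N s)
  (no _)  → nothing

bools : List Bool
bools = true ∷ false ∷ []

subsets : ∀ m → List (Subset m)
subsets = words bools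

tables : ∀ m → List (Subset m × Vec (Subset m) m)
tables m = cartesianProduct (subsets m) (words (subsets m) m)

graphs : ∀ m → List (Graph m)
graphs m = mapMaybe toGraph (tables m)

private
  ∈-bools : ∀ b → b ∈ˡ bools
  ∈-bools true  = here refl
  ∈-bools false = there (here refl)

  ∈-mapMaybe-toGraph : (G : Graph m) → ∀ {ts} → (vertices G , neighbours G) ∈ˡ ts →
                       G ∈ˡ mapMaybe toGraph ts
  ∈-mapMaybe-toGraph (graph V N s) (here refl) with isSimple? V N
  ... | yes _ = here refl
  ... | no ¬s = ⊥-elim (¬s (recompute (isSimple? V N) s))
  ∈-mapMaybe-toGraph G {(V , N) ∷ _} (there p) with isSimple? V N
  ... | yes _ = there (∈-mapMaybe-toGraph G p)
  ... | no _  = ∈-mapMaybe-toGraph G p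

  mapMaybe-toGraph-fresh : ∀ {V N} .{s : IsSimple {m} V N} ts → All ((V , N) ≢_) ts →
                           All (graph V N s ≢_) (mapMaybe toGraph ts)
  mapMaybe-toGraph-fresh []             []       = []
  mapMaybe-toGraph-fresh ((V , N) ∷ ts) (p ∷ ps) with isSimple? V N
  ... | yes _ = (λ where refl → p refl) ∷ mapMaybe-toGraph-fresh ts ps
  ... | no _  = mapMaybe-toGraph-fresh ts ps

  mapMaybe-toGraph-unique : (ts : List (Subset m × Vec (Subset m) m)) → Unique ts →
                            Unique (mapMaybe toGraph ts)
  mapMaybe-toGraph-unique []             []         = []
  mapMaybe-toGraph-unique ((V , N) ∷ ts) (t∉ ∷ ts!) with isSimple? V N
  ... | yes _ = mapMaybe-toGraph-fresh ts t∉ ∷ mapMaybe-toGraph-unique ts ts!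
  ... | no _  = mapMaybe-toGraph-unique ts ts!

∈-graphs : (G : Graph m) → G ∈ˡ graphs m
∈-graphs G = ∈-mapMaybe-toGraph G
  (∈-cartesianProduct⁺ (∈-words ∈-bools (vertices G)) (∈-words (∈-words ∈-bools) (neighbours G)))

graphs-unique : ∀ m → Unique (graphs m)
graphs-unique m = mapMaybe-toGraph-unique (tables m)
  (Unique.cartesianProduct⁺ (subsets! m) (words-unique (subsets! m) m))
  where
  subsets! : ∀ k → Unique (subsets k)
  subsets! = words-unique (((λ ()) ∷ []) ∷ [] ∷ [])

_⇔-dec_ : ∀ {a b} {A : Set a} {B : Set b} → Dec A → Dec B → Dec (A ⇔ B)
a? ⇔-dec b? = map′ (λ (f , g) → mk⇔ f g) (λ e → Equivalence.to e , Equivalence.from e)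
  ((a? →-dec b?) ×-dec (b? →-dec a?))

private
  lookup-injective : ∀ {a} {A : Set a} {xs : List A} → Unique xs →
                     ∀ i j → lookup xs i ≡ lookup xs j → i ≡ j
  lookup-injective (_ ∷ _)   fzero    fzero    _  = refl
  lookup-injective (x∉ ∷ _)  fzero    (fsuc j) eq = ⊥-elim (All.lookup x∉ (∈-lookup j) eq)
  lookup-injective (x∉ ∷ _)  (fsuc i) fzero    eq = ⊥-elim (All.lookup x∉ (∈-lookup i) (sym eq))
  lookup-injective (_ ∷ xs!) (fsuc i) (fsuc j) eq = cong fsuc (lookup-injective xs! i j eq)

unique⇒length≤ : {xs : List (Fin m)} → Unique xs → length xs ≤ m
unique⇒length≤ xs! = Fin.injective⇒≤ λ {i} {j} → lookup-injective xs! i j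

listsOfLength : ∀ m → ℕ → List (List (Fin m))
listsOfLength m k = mapˡ toListᵛ (words (allFin m) k)

shortLists : ∀ m → List (List (Fin m))
shortLists m = concatMap (listsOfLength m) (upTo (suc m))

∈-shortLists : (xs : List (Fin m)) → length xs ≤ m → xs ∈ˡ shortLists m
∈-shortLists {m} xs ≤m = ∈-concatMap⁺ (listsOfLength m) (lose (∈-upTo⁺ (s≤s ≤m)) xs∈)
  where
  xs∈ : xs ∈ˡ listsOfLength m (length xs)
  xs∈ = subst (_∈ˡ listsOfLength m (length xs)) (Vec.toList∘fromList xs)
    (∈-map⁺ toListᵛ (∈-words ∈-allFin (fromListᵛ xs)))

∃unique? : {P : List (Fin m) → Set} → (∀ xs → Dec (P xs)) → Dec (∃ λ xs → Unique xs × P xs)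
∃unique? {m} P? = map′
  (λ p → let xs , _ , q = find p in xs , q)
  (λ (xs , xs! , p) → lose (∈-shortLists xs (unique⇒length≤ xs!)) (xs! , p))
  (any? (λ xs → unique? Fin._≟_ xs ×-dec P? xs) (shortLists m))

module _ {R : Fin m → Fin m → Set} (R? : ∀ u v → Dec (R u v)) where

  private
    Path : Fin m → List (Fin m) → Fin m → Set
    Path u []       v = u ≡ v
    Path u (w ∷ ws) v = R u w × Path w ws v

    path? : ∀ u ws v → Dec (Path u ws v)
    path? u []       v = u Fin.≟ v
    path? u (w ∷ ws) v = R? u w ×-dec path? w ws v

    path⇒star : ∀ {u} ws {v} → Path u ws v → Star R u v
    path⇒star []       refl    = ε
    path⇒star (w ∷ ws) (r , p) = r ◅ path⇒star ws p

    suffix : ∀ {u w} ws {v} → u ∈ˡ w ∷ ws → Unique (w ∷ ws) → Path w ws v →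
             ∃ λ ws′ → Unique (u ∷ ws′) × Path u ws′ v
    suffix ws       (here refl) ws!       p       = ws , ws! , p
    suffix (x ∷ ws) (there q)   (_ ∷ ws!) (_ , p) = suffix ws q ws! p

    star⇒path : ∀ {u v} → Star R u v → ∃ λ ws → Unique (u ∷ ws) × Path u ws v
    star⇒path ε = [] , [] ∷ [] , refl
    star⇒path {u} (_◅_ {j = w} r s) with star⇒path s
    ... | ws , ws! , p with DecMembership._∈?_ Fin._≟_ u (w ∷ ws)
    ...   | yes u∈ = suffix ws u∈ ws! p
    ...   | no  u∉ = w ∷ ws , All.¬Any⇒All¬ _ u∉ ∷ ws! , r , p

  star? : ∀ u v → Dec (Star R u v)
  star? u v = map′
    (λ (ws , _ , p) → path⇒star ws p)
    (λ s → case star⇒path s of λ where (ws , _ ∷ ws! , p) → ws , ws! , p)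
    (∃unique? λ ws → path? u ws v)

adj? : (G : Graph m) → ∀ u v → Dec (Adj G u v)
adj? G u v = v ∈? lookupᵛ (neighbours G) u

_⊑?_ : (H G : Graph m) → Dec (H ⊑ G)
H ⊑? G = (vertices H ⊆? vertices G) ×-dec
  (Fin.all? λ u → Fin.all? λ v → adj? H u v →-dec adj? G u v)

connected? : (G : Graph m) → Dec (Connected G)
connected? G = Fin.all? λ u → Fin.all? λ v →
  (u ∈? vertices G) →-dec ((v ∈? vertices G) →-dec star? (adj? G) u v)

isCycle? : (C : Graph m) → Dec (IsCycle C)
isCycle? {m} C = ∃unique? λ xs → (3 ≤ℕ? length xs) ×-dec
  (Fin.all? λ u → (u ∈? vertices C) ⇔-dec DecMembership._∈?_ Fin._≟_ u xs) ×-dec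
  (Fin.all? λ u → Fin.all? λ v → adj? C u v ⇔-dec
    ((u , v) ∈ᵖ? zip xs (rotate xs) ⊎-dec (v , u) ∈ᵖ? zip xs (rotate xs)))
  where
  open DecMembership (Product.≡-dec (Fin._≟_ {m}) (Fin._≟_ {m})) using () renaming (_∈?_ to _∈ᵖ?_)

acyclic? : (G : Graph m) → Dec (Acyclic G)
acyclic? {m} G = map′
  (λ ¬p (C , q) → ¬p (lose (∈-graphs C) q))
  (λ ¬q p → let C , _ , q = find p in ¬q (C , q))
  (any? (λ C → (C ⊑? G) ×-dec isCycle? C) (graphs m) →-dec no λ ())

isTree? : (G : Graph m) → Dec (IsTree G)
isTree? G = connected? G ×-dec acyclic? G

subtrees : Graph m → List (Graph m)
subtrees {m} G = filter (λ H → (H ⊑? G) ×-dec isTree? H) (graphs m)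

numSubtrees : Graph m → ℕ
numSubtrees G = length (subtrees G)

module _ (n : ℕ) {R : ℕ → ℕ → Set} (R? : ∀ i j → Dec (R i j)) where

  joined? : (u v : Fin n) → Dec (R (toℕ u) (toℕ v) ⊎ R (toℕ v) (toℕ u))
  joined? u v = R? (toℕ u) (toℕ v) ⊎-dec R? (toℕ v) (toℕ u)

  table : Vec (Subset n) n
  table = tabulate λ u → tabulate λ v → does (joined? u v)

  ∈-table : ∀ u v → v ∈ lookupᵛ table u ⇔ (R (toℕ u) (toℕ v) ⊎ R (toℕ v) (toℕ u))
  ∈-table u v = mk⇔
    (λ p → does-true (joined? u v) (trans (sym entry) (Vec.[]=⇒lookup p)))
    (λ e → Vec.lookup⇒[]= v _ (trans entry (dec-true (joined? u v) e)))
    where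
    entry : lookupᵛ (lookupᵛ table u) v ≡ does (joined? u v)
    entry = trans (cong (λ r → lookupᵛ r v) (Vec.lookup∘tabulate _ u)) (Vec.lookup∘tabulate _ v)

    does-true : {A : Set} (a? : Dec A) → does a? ≡ true → A
    does-true (yes a) _ = a

  -- The graph on all of Fin n in which i and j are adjacent iff R i j or R j i.
  fromEdges : (∀ {i j} → R i j → i < j) → Graph n
  fromEdges R⇒< = graph ⊤ table (isSimple
    (λ _ _ _ → ∈⊤)
    (λ u v p → Equivalence.from (∈-table v u) (swap (Equivalence.to (∈-table u v) p)))
    (λ u p → [ ℕ.<-irrefl refl ∘ R⇒< , ℕ.<-irrefl refl ∘ R⇒< ]′ (Equivalence.to (∈-table u u) p)))

-- Star with centre 0 and leaves 1, …, n - 1.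
StarEdge : ℕ → ℕ → Set
StarEdge i j = i ≡ 0 × 0 < j

USEdge : ℕ → ℕ → Set
USEdge i j = StarEdge i j ⊎ (i ≡ 1 × j ≡ 2)

US : ∀ n → Graph n
US n = fromEdges n {USEdge}
  (λ i j → ((i ≟ℕ 0) ×-dec (0 <ℕ? j)) ⊎-dec ((i ≟ℕ 1) ×-dec (j ≟ℕ 2)))
  λ where
    (inj₁ (refl , 0<j))  → 0<j
    (inj₂ (refl , refl)) → ℕ.≤-refl

-- Triangle on 0, 1, 2, and path 2, 3, …, n - 1 on n - 2 vertices, sharing the
-- end vertex 2 of the path.
TriangleEdge : ℕ → ℕ → Set
TriangleEdge i j = i < j × j ≤ 2

TailEdge : ℕ → ℕ → Set
TailEdge i j = 2 ≤ i × j ≡ suc i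

UPEdge : ℕ → ℕ → Set
UPEdge i j = TriangleEdge i j ⊎ TailEdge i j

UP : ∀ n → Graph n
UP n = fromEdges n {UPEdge}
  (λ i j → ((i <ℕ? j) ×-dec (j ≤ℕ? 2)) ⊎-dec ((2 ≤ℕ? i) ×-dec (j ≟ℕ suc i)))
  λ where
    (inj₁ (i<j , _))  → i<j
    (inj₂ (_ , refl)) → ℕ.≤-refl

{-# OPTIONS --safe #-}
module Submission where

-- A unicyclic graph arises from its cycle by attaching pendant vertices one at
-- a time: a connected subgraph containing the cycle is induced, since a chord
-- would close one of its paths into a second cycle.
-- Attaching v at u turns n(G) into n(G) + 1 + f(G,u), where f(G,u) counts the
-- subtrees through u, and f(G,w) into f(G,w) plus the number of subtrees through
-- u and w.  With 3 + k vertices this gives 6 + k ≤ f(G,w) ≤ 6 · 2ᵏ; summing up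
-- bounds n(G), and US and UP attain the extremes at each step.  On the cycle of
-- length c the nonempty subtrees are the c² arcs, c(c+1)/2 of them through a
-- given vertex.

open import Defs
open import Data.Bool using (true)
open import Data.Empty using (⊥; ⊥-elim)
open import Data.Fin using (Fin; toℕ; _≟_; fromℕ<) renaming (zero to fzero; suc to fsuc)
import Data.Fin.Properties as Fin
open import Data.Fin.Subset using (Subset; _∈_; _∉_; _⊆_; ∣_∣; inside; outside)
open import Data.Fin.Subset.Properties using (_∈?_; ⊆-antisym; nonempty?; p⊂q⇒∣p∣<∣q∣)
open import Data.List using (List; []; _∷_; _∷ʳ_; _++_; zip; map; length; filter; upTo)
import Data.List.Membership.DecPropositional as DecMembership
open import Data.List.Membership.Propositional using () renaming (_∈_ to _∈ˡ_)
open import Data.List.Membership.Propositional.Properties using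
  (∈-map⁺; ∈-map⁻; ∈-++⁺ˡ; ∈-++⁺ʳ; ∈-++⁻; ∈-∃++; ∈-upTo⁺; ∈-upTo⁻; ∈-filter⁺; ∈-filter⁻)
open import Data.List.Properties using (length-map; length-++; length-++-sucʳ; length-upTo)
import Data.List.Relation.Unary.All as All
import Data.List.Relation.Unary.All.Properties as All
open import Data.List.Relation.Unary.AllPairs using ([]; _∷_)
open import Data.List.Relation.Unary.Any using (here; there)
open import Data.List.Relation.Unary.Unique.Propositional using (Unique)
import Data.List.Relation.Unary.Unique.Propositional.Properties as Unique
open import Data.Nat using
  (ℕ; zero; suc; _+_; _*_; _∸_; _^_; _/_; _%_; _≤_; _<_; _≥_; z≤n; s≤s; _<?_; _≤?_)
open import Data.Nat.DivMod using (m%n<n; m<n⇒m%n≡m; %-distribˡ-+; [m+n]%n≡m%n; m≡m%n+[m/n]*n; n%n≡0)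
import Data.Nat.Properties as ℕ
open import Data.Nat.Tactic.RingSolver using (solve-∀)
open import Data.Product using (∃; ∃₂; _×_; _,_; proj₁; proj₂; uncurry)
import Data.Product.Properties as Product
open import Data.Sum using (_⊎_; inj₁; inj₂; swap; [_,_]′)
open import Data.Vec using (Vec; []; _∷_; tabulate; here; there) renaming (lookup to lookupᵛ)
import Data.Vec.Properties as Vec
open import Function using (_∘_; case_of_; id)
open import Function.Bundles using (_⇔_; mk⇔; Equivalence)
open import Relation.Binary.Construct.Closure.ReflexiveTransitive using
  (Star; ε; _◅_; _◅◅_) renaming (map to mapˢ)
open import Relation.Binary.PropositionalEquality using
  (_≡_; _≢_; refl; sym; trans; cong; cong₂; subst; subst₂)
open import Relation.Nullary using (Dec; yes; no; ¬_; ¬?)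
open import Relation.Nullary.Decidable using (_×-dec_; _⊎-dec_; does; dec-true)

open Equivalence using (to; from)

-- The next vertex may be attached anywhere, so the bounds on f(G,w) have to hold at every vertex w.
-- The term added to f(G,w) is at most f(G,u), whence the doubling, and at least 1, because a
-- spanning tree contains both u and w. Attaching always at one centre means w = u, and the doubling
-- is exact; attaching always at the newest leaf raises the count at the point of attachment by
-- exactly 1. This is why star and path are extremal. The constants come from the triangle: it has
-- 3² + 1 = 10 subtrees, 6 of them through a given vertex. Longer cycles do not arise from shorter
-- ones by attaching vertices; a cycle on 3 + k vertices is a base case of its own, and its counts
-- have to be compared with the bounds for the same k.

private
  variable
    m n k l : ℕ
    A B : Set
    P Q : A → Set

-- Cardinalities of predicates

-- A relation instead of a function: a count can be moved along bijections and disjoint unions, and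
-- the enumeration behind `numSubtrees` never has to be evaluated. By `counts-unique` the number is
-- determined.
Counts : (A → Set) → ℕ → Set
Counts {A} P k = ∃ λ (xs : List A) → Unique xs × (∀ x → x ∈ˡ xs ⇔ P x) × length xs ≡ k

-- Pigeonhole: with one occurrence of the head `x` cut out of `ys`, the rest still contains the tail
-- of `xs`, in which `x` does not recur.
unique-⊆⇒length≤ : {xs ys : List A} → Unique xs → (∀ {x} → x ∈ˡ xs → x ∈ˡ ys) → length xs ≤ length ys
unique-⊆⇒length≤ [] _ = z≤n
unique-⊆⇒length≤ {xs = x ∷ xs} (x∉ ∷ xs!) ⊆ys with ∈-∃++ (⊆ys (here refl))
... | as , bs , refl = ℕ.≤-trans
  (s≤s (unique-⊆⇒length≤ xs! λ z∈ → skip z∈ (∈-++⁻ as (⊆ys (there z∈)))))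
  (ℕ.≤-reflexive (sym (length-++-sucʳ as x bs)))
  where
  skip : ∀ {z} → z ∈ˡ xs → z ∈ˡ as ⊎ z ∈ˡ x ∷ bs → z ∈ˡ as ++ bs
  skip z∈ (inj₁ p)           = ∈-++⁺ˡ p
  skip z∈ (inj₂ (here refl)) = ⊥-elim (All.lookup x∉ z∈ refl)
  skip z∈ (inj₂ (there p))   = ∈-++⁺ʳ as p

counts-mono : (∀ x → P x → Q x) → Counts P k → Counts Q l → k ≤ l
counts-mono P⇒Q (xs , xs! , xs⇔ , refl) (ys , _ , ys⇔ , refl) =
  unique-⊆⇒length≤ xs! λ {x} → from (ys⇔ x) ∘ P⇒Q x ∘ to (xs⇔ x)

counts-unique : Counts P k → Counts P l → k ≡ l
counts-unique p q = ℕ.≤-antisym (counts-mono (λ _ z → z) p q) (counts-mono (λ _ z → z) q p)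

counts-cong : (∀ x → P x ⇔ Q x) → Counts P k → Counts Q k
counts-cong P⇔Q (xs , xs! , xs⇔ , len) =
  xs , xs! , (λ x → mk⇔ (to (P⇔Q x) ∘ to (xs⇔ x)) (from (xs⇔ x) ∘ from (P⇔Q x))) , len

counts-none : (∀ x → ¬ P x) → Counts P 0
counts-none ¬P = [] , [] , (λ x → mk⇔ (λ ()) (⊥-elim ∘ ¬P x)) , refl

counts-one : (x : A) → Counts (_≡ x) 1
counts-one x = x ∷ [] , (All.[] ∷ []) , (λ _ → mk⇔ (λ where (here p) → p) here) , refl

counts-⊎ : (∀ x → P x → ¬ Q x) → Counts P k → Counts Q l → Counts (λ x → P x ⊎ Q x) (k + l)
counts-⊎ disj (xs , xs! , xs⇔ , refl) (ys , ys! , ys⇔ , refl) =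
  xs ++ ys , Unique.++⁺ xs! ys! (λ {x} (p , q) → disj x (to (xs⇔ x) p) (to (ys⇔ x) q)) ,
  (λ x → mk⇔
    (λ p → [ inj₁ ∘ to (xs⇔ x) , inj₂ ∘ to (ys⇔ x) ]′ (∈-++⁻ xs p))
    [ ∈-++⁺ˡ ∘ from (xs⇔ x) , ∈-++⁺ʳ xs ∘ from (ys⇔ x) ]′) ,
  length-++ xs

private
  map-unique : (f : A → B) {xs : List A} → (∀ {x y} → x ∈ˡ xs → y ∈ˡ xs → f x ≡ f y → x ≡ y) →
               Unique xs → Unique (map f xs)
  map-unique f inj []         = []
  map-unique f inj (x∉ ∷ xs!) =
    All.tabulate (λ p eq → case ∈-map⁻ f p of λ where
      (y , y∈ , refl) → All.lookup x∉ y∈ (inj (here refl) (there y∈) eq))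
    ∷ map-unique f (λ p q → inj (there p) (there q)) xs!

-- Injectivity is asked on `P` only, since `attach` and `arc` are injective only on suitable graphs
-- and index pairs.
counts-image : (f : A → B) → (∀ {x y} → P x → P y → f x ≡ f y → x ≡ y) →
               Counts P k → Counts (λ y → ∃ λ x → P x × y ≡ f x) k
counts-image f inj (xs , xs! , xs⇔ , refl) =
  map f xs , map-unique f (λ {x} {y} p q → inj (to (xs⇔ x) p) (to (xs⇔ y) q)) xs! ,
  (λ y → mk⇔
    (λ p → let x , x∈ , eq = ∈-map⁻ f p in x , to (xs⇔ x) x∈ , eq)
    (λ where (x , px , refl) → ∈-map⁺ f (from (xs⇔ x) px))) ,
  length-map f xs

counts-< : ∀ n → Counts (_< n) n
counts-< n = upTo n , Unique.upTo⁺ n , (λ _ → mk⇔ ∈-upTo⁻ ∈-upTo⁺) , length-upTo n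

counts-filter : {P : Graph m → Set} (P? : ∀ H → Dec (P H)) → Counts P (length (filter P? (graphs m)))
counts-filter {m} P? =
  filter P? (graphs m) , Unique.filter⁺ P? (graphs-unique m) ,
  (λ H → mk⇔ (proj₂ ∘ ∈-filter⁻ P? {xs = graphs m}) (∈-filter⁺ P? (∈-graphs H))) , refl

counts-∈ : (p : Subset m) → Counts (_∈ p) ∣ p ∣
counts-∈ []            = counts-none λ ()
counts-∈ (inside ∷ p)  = counts-cong
  (λ x → mk⇔
    (λ where (inj₁ refl) → here
             (inj₂ (y , y∈ , refl)) → there y∈)
    (λ where here → inj₁ refl
             (there q) → inj₂ (_ , q , refl)))
  (counts-⊎ (λ where _ refl (_ , _ , ())) (counts-one fzero)
    (counts-image fsuc (λ _ _ → Fin.suc-injective) (counts-∈ p)))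
counts-∈ (outside ∷ p) = counts-cong
  (λ x → mk⇔ (λ where (y , y∈ , refl) → there y∈) (λ where (there q) → _ , q , refl))
  (counts-image fsuc (λ _ _ → Fin.suc-injective) (counts-∈ p))

-- Graphs from decidable relations, and extensionality

subsetOf : {P : Fin m → Set} → (∀ u → Dec (P u)) → Subset m
subsetOf P? = tabulate (does ∘ P?)

∈-subsetOf : {P : Fin m → Set} (P? : ∀ u → Dec (P u)) → ∀ u → u ∈ subsetOf P? ⇔ P u
∈-subsetOf P? u = mk⇔
  (λ p → does-true (P? u) (trans (sym (Vec.lookup∘tabulate _ u)) (Vec.[]=⇒lookup p)))
  (λ p → Vec.lookup⇒[]= u _ (trans (Vec.lookup∘tabulate _ u) (dec-true (P? u) p)))
  where
  does-true : {A : Set} (a? : Dec A) → does a? ≡ true → A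
  does-true (yes a) _ = a

subset-ext : {p q : Subset m} → (∀ u → u ∈ p ⇔ u ∈ q) → p ≡ q
subset-ext p⇔q = ⊆-antisym (λ {u} → to (p⇔q u)) (λ {u} → from (p⇔q u))

-- The laws of a graph are irrelevant, so equality of the two tables is enough.
graph-ext : {G H : Graph m} → (∀ u → u ∈ vertices G ⇔ u ∈ vertices H) →
            (∀ u v → Adj G u v ⇔ Adj H u v) → G ≡ H
graph-ext {G = graph V N _} {graph V′ N′ _} V⇔ N⇔ = eq (subset-ext V⇔) (tables-ext λ u → subset-ext (N⇔ u))
  where
  eq : ∀ {V V′ N N′} .{s s′} → V ≡ V′ → N ≡ N′ → graph V N s ≡ graph V′ N′ s′
  eq refl refl = refl

  tables-ext : {N N′ : Vec A n} → (∀ u → lookupᵛ N u ≡ lookupᵛ N′ u) → N ≡ N′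
  tables-ext {N = []}    {[]}    _ = refl
  tables-ext {N = _ ∷ _} {_ ∷ _} e = cong₂ _∷_ (e fzero) (tables-ext (e ∘ fsuc))

⊑-antisym : {G H : Graph m} → G ⊑ H → H ⊑ G → G ≡ H
⊑-antisym (V≤ , N≤) (V≥ , N≥) =
  graph-ext (λ _ → mk⇔ V≤ V≥) (λ u v → mk⇔ (N≤ u v) (N≥ u v))

⊑-trans : (G H K : Graph m) → G ⊑ H → H ⊑ K → G ⊑ K
⊑-trans _ _ _ (V₁ , N₁) (V₂ , N₂) = V₂ ∘ V₁ , λ u v → N₂ u v ∘ N₁ u v

module _ (G : Graph m) where
  adj-sym : ∀ {u v} → Adj G u v → Adj G v u
  adj-sym = IsSimple.symmetric (simple! G) _ _

  adj-≢ : ∀ {u v} → Adj G u v → u ≢ v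
  adj-≢ e refl = IsSimple.irreflexive (simple! G) _ e

  adj-∈ˡ : ∀ {u v} → Adj G u v → u ∈ vertices G
  adj-∈ˡ = IsSimple.endpoint (simple! G) _ _

  adj-∈ʳ : ∀ {u v} → Adj G u v → v ∈ vertices G
  adj-∈ʳ = adj-∈ˡ ∘ adj-sym

-- The relational description of a graph. After `build` has tabulated it, only `∈-build` and
-- `adj-build` are used, and no table has to be inspected again.
record GraphSpec (m : ℕ) : Set₁ where
  field
    Vertex  : Fin m → Set
    Edge    : Fin m → Fin m → Set
    vertex? : ∀ u → Dec (Vertex u)
    edge?   : ∀ u v → Dec (Edge u v)
    ends    : ∀ u v → Edge u v → Vertex u
    flip    : ∀ u v → Edge u v → Edge v u
    loop    : ∀ u → ¬ Edge u u

module _ (S : GraphSpec m) where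
  open GraphSpec S
  private
    N : Vec (Subset m) m
    N = tabulate λ u → subsetOf (edge? u)

    adj : ∀ u v → v ∈ lookupᵛ N u ⇔ Edge u v
    adj u v = subst (λ p → v ∈ p ⇔ Edge u v) (sym (Vec.lookup∘tabulate _ u)) (∈-subsetOf (edge? u) v)

  build : Graph m
  build = graph (subsetOf vertex?) N (isSimple
    (λ u v e → from (∈-subsetOf vertex? u) (ends u v (to (adj u v) e)))
    (λ u v e → from (adj v u) (flip u v (to (adj u v) e)))
    (λ u e → loop u (to (adj u u) e)))

  ∈-build : ∀ u → u ∈ vertices build ⇔ Vertex u
  ∈-build = ∈-subsetOf vertex?

  adj-build : ∀ u v → Adj build u v ⇔ Edge u v
  adj-build = adj

-- Periodic parametrization of a cycle

Joins : Fin m → Fin m → Fin m → Fin m → Set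
Joins u v a b = (a ≡ u × b ≡ v) ⊎ (a ≡ v × b ≡ u)

joins-flip : {u v a b : Fin m} → Joins u v a b → Joins u v b a
joins-flip (inj₁ (p , q)) = inj₂ (q , p)
joins-flip (inj₂ (p , q)) = inj₁ (q , p)

-- p winds around the cycle C of length 3 + k.
record Winding (C : Graph m) (k : ℕ) : Set where
  field
    p        : ℕ → Fin m
    p-period : ∀ i → p ((3 + k) + i) ≡ p i
    p-suc    : ∀ {i j} → p i ≡ p j → p (suc i) ≡ p (suc j)
    p-inj    : ∀ {i j} → i < 3 + k → j < 3 + k → p i ≡ p j → i ≡ j
    p-onto   : ∀ {u} → u ∈ vertices C → ∃ λ i → u ≡ p i
    adj-p    : ∀ {u v} → Adj C u v ⇔ ∃ λ i → Joins (p i) (p (suc i)) u v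

  p-multiple : ∀ n i → p (n * (3 + k) + i) ≡ p i
  p-multiple zero    i = refl
  p-multiple (suc n) i = trans (cong p (ℕ.+-assoc (3 + k) (n * (3 + k)) i))
    (trans (p-period _) (p-multiple n i))

  p-mod : ∀ i → p (i % (3 + k)) ≡ p i
  p-mod i = trans (sym (p-multiple (i / (3 + k)) _))
    (cong p (trans (ℕ.+-comm _ (i % (3 + k))) (sym (m≡m%n+[m/n]*n i (3 + k)))))

  p-shift : ∀ t {i j} → p i ≡ p j → p (t + i) ≡ p (t + j)
  p-shift zero    eq = eq
  p-shift (suc t) eq = p-suc (p-shift t eq)

  -- One step back is `2 + k` steps forward, the period being `3 + k`.
  p-pred : ∀ {i j} → p (suc i) ≡ p (suc j) → p i ≡ p j
  p-pred {i} {j} eq = trans (sym (back i)) (trans (p-shift (2 + k) eq) (back j))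
    where
    back : ∀ i → p (2 + k + suc i) ≡ p i
    back i = trans (cong p (ℕ.+-suc (2 + k) i)) (p-period i)

  p-cancel : ∀ t {i j} → p (t + i) ≡ p (t + j) → p i ≡ p j
  p-cancel zero    eq = eq
  p-cancel (suc t) eq = p-cancel t (p-pred eq)

  -- Cancelling the offset `i` moves the window to 0, where `p-inj` applies. This is the source of
  -- the contradictions below: different offsets within one period cannot give the same vertex.
  p-window : ∀ {i s t} → s < 3 + k → t < 3 + k → p (s + i) ≡ p (t + i) → s ≡ t
  p-window {i} {s} {t} s< t< eq = p-inj s< t<
    (p-cancel i (trans (cong p (ℕ.+-comm i s)) (trans eq (cong p (ℕ.+-comm t i)))))

  p-previous : ∀ i → ∃ λ j → p (suc j) ≡ p i
  p-previous i = 2 + k + i , p-period i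

  p-edge : ∀ i → Adj C (p i) (p (suc i))
  p-edge i = from adj-p (i , inj₁ (refl , refl))

  p-vertex : ∀ i → p i ∈ vertices C
  p-vertex i = adj-∈ˡ C (p-edge i)

module _ (d : A) where
  nth : List A → ℕ → A
  nth []       _       = d
  nth (x ∷ _)  zero    = x
  nth (_ ∷ xs) (suc i) = nth xs i

  nth-∈ : ∀ xs {i} → i < length xs → nth xs i ∈ˡ xs
  nth-∈ (x ∷ xs) {zero}  _       = here refl
  nth-∈ (x ∷ xs) {suc i} (s≤s p) = there (nth-∈ xs p)

  ∈-nth : ∀ {x xs} → x ∈ˡ xs → ∃ λ i → i < length xs × x ≡ nth xs i
  ∈-nth (here refl) = 0 , s≤s z≤n , refl
  ∈-nth (there p)   = let i , i< , eq = ∈-nth p in suc i , s≤s i< , eq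

  nth-injective : ∀ {xs i j} → Unique xs → i < length xs → j < length xs → nth xs i ≡ nth xs j → i ≡ j
  nth-injective {i = zero}  {zero}  _          _       _       _  = refl
  nth-injective {i = zero}  {suc j} (x∉ ∷ _)  _       (s≤s q) eq = ⊥-elim (All.lookup x∉ (nth-∈ _ q) eq)
  nth-injective {i = suc i} {zero}  (x∉ ∷ _)  (s≤s p) _       eq = ⊥-elim (All.lookup x∉ (nth-∈ _ p) (sym eq))
  nth-injective {i = suc i} {suc j} (_ ∷ xs!) (s≤s p) (s≤s q) eq = cong suc (nth-injective xs! p q eq)

  nth-length : ∀ xs → nth xs (length xs) ≡ d
  nth-length []       = refl
  nth-length (_ ∷ xs) = nth-length xs

  -- The default value d takes the place of the entry that rotate moves to the end.
  ∈-zip : ∀ {u v} x ys → (u , v) ∈ˡ zip (x ∷ ys) (ys ∷ʳ d) →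
          ∃ λ i → i < length (x ∷ ys) × u ≡ nth (x ∷ ys) i × v ≡ nth (x ∷ ys) (suc i)
  ∈-zip x []       (here refl) = 0 , s≤s z≤n , refl , refl
  ∈-zip x (y ∷ ys) (here refl) = 0 , s≤s z≤n , refl , refl
  ∈-zip x (y ∷ ys) (there q)   =
    let i , i< , eq , eq′ = ∈-zip y ys q in suc i , s≤s i< , eq , eq′

  zip-∈ : ∀ x ys {i} → i < length (x ∷ ys) →
          (nth (x ∷ ys) i , nth (x ∷ ys) (suc i)) ∈ˡ zip (x ∷ ys) (ys ∷ʳ d)
  zip-∈ x []       {zero}  _       = here refl
  zip-∈ x []       {suc i} (s≤s ())
  zip-∈ x (y ∷ ys) {zero}  _       = here refl
  zip-∈ x (y ∷ ys) {suc i} (s≤s p) = there (zip-∈ y ys p)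

-- `p i` is the entry at position `i % c` of the cyclic list. The default value of `nth` is the head
-- of the list, so that reading one place past the end wraps around.
winding : {C : Graph m} → IsCycle C → ∃ λ k → order C ≡ 3 + k × Winding C k
winding (_ ∷ []    , _ , s≤s () , _)
winding (_ ∷ _ ∷ [] , _ , s≤s (s≤s ()) , _)
winding {C = C} (xs@(x ∷ y ∷ z ∷ zs) , xs! , _ , V⇔ , E⇔) =
  length zs ,
  counts-unique (counts-∈ (vertices C)) (xs , xs! , (λ u → mk⇔ (from (V⇔ u)) (to (V⇔ u))) , refl) ,
  record
  { p        = λ i → q (i % c)
  ; p-period = λ i → cong q (trans (cong (_% c) (ℕ.+-comm c i)) ([m+n]%n≡m%n i c))
  ; p-suc    = λ {i} {j} eq → trans (q-suc i) (trans
      (cong (λ r → q (suc r)) (q-inj (m%n<n i c) (m%n<n j c) eq)) (sym (q-suc j)))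
  ; p-inj    = λ i< j< eq → q-inj i< j<
      (trans (cong q (sym (m<n⇒m%n≡m i<))) (trans eq (cong q (m<n⇒m%n≡m j<))))
  ; p-onto   = λ {u} u∈ → let i , i< , eq = ∈-nth x (to (V⇔ u) u∈) in
      i , trans eq (cong q (sym (m<n⇒m%n≡m i<)))
  ; adj-p    = λ {u} {v} → mk⇔
      ([ (λ e → let i , eq , eq′ = consecutive e in i , inj₁ (eq , eq′)) ,
         (λ e → let i , eq , eq′ = consecutive e in i , inj₂ (eq′ , eq)) ]′ ∘ to (E⇔ u v))
      (λ where
        (i , inj₁ (refl , refl)) → from (E⇔ u v) (inj₁ (p-∈ i))
        (i , inj₂ (refl , refl)) → from (E⇔ u v) (inj₂ (p-∈ i)))
  }
  where
  c = 3 + length zs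

  q : ℕ → Fin _
  q = nth x xs

  q-inj : ∀ {i j} → i < c → j < c → q i ≡ q j → i ≡ j
  q-inj = nth-injective x xs!

  q-suc : ∀ i → q (suc i % c) ≡ q (suc (i % c))
  q-suc i with suc (i % c) <? c
  ... | yes lt = cong q (trans (%-distribˡ-+ 1 i c) (m<n⇒m%n≡m lt))
  -- At the wrap the left side is the head `x`, and the right side reads past the end, where the
  -- default is `x` too.
  ... | no ¬lt = trans (cong q (trans (%-distribˡ-+ 1 i c) (trans (cong (_% c) wrap) (n%n≡0 c))))
                   (sym (trans (cong q wrap) (nth-length x xs)))
    where
    wrap : suc (i % c) ≡ c
    wrap = ℕ.≤-antisym (m%n<n i c) (ℕ.≮⇒≥ ¬lt)

  consecutive : ∀ {u v} → (u , v) ∈ˡ zip xs (rotate xs) →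
                ∃ λ i → u ≡ q (i % c) × v ≡ q (suc i % c)
  consecutive e =
    let i , i< , eq , eq′ = ∈-zip x x (y ∷ z ∷ zs) e
        i≡ = m<n⇒m%n≡m i<
    in i , trans eq (cong q (sym i≡)) , trans eq′ (sym (trans (q-suc i) (cong (q ∘ suc) i≡)))

  p-∈ : ∀ i → (q (i % c) , q (suc i % c)) ∈ˡ zip xs (rotate xs)
  p-∈ i = subst (λ w → (q (i % c) , w) ∈ˡ zip xs (rotate xs)) (sym (q-suc i))
    (zip-∈ x x (y ∷ z ∷ zs) (m%n<n i c))

-- Single vertices, restriction and attachment

singleSpec : Fin m → GraphSpec m
singleSpec v = record
  { Vertex = _≡ v ; Edge = λ _ _ → ⊥ ; vertex? = _≟ v ; edge? = λ _ _ → no id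
  ; ends = λ _ _ () ; flip = λ _ _ () ; loop = λ _ () }

single : Fin m → Graph m
single = build ∘ singleSpec

∈-single : (v u : Fin m) → u ∈ vertices (single v) ⇔ u ≡ v
∈-single v = ∈-build (singleSpec v)

adj-single : (v : Fin m) → ∀ {a b} → ¬ Adj (single v) a b
adj-single v = to (adj-build (singleSpec v) _ _)

restrictSpec : {Q : Fin m → Set} → (∀ u → Dec (Q u)) → Graph m → GraphSpec m
restrictSpec {Q = Q} Q? G = record
  { Vertex  = λ u → u ∈ vertices G × Q u
  ; Edge    = λ u v → Adj G u v × Q u × Q v
  ; vertex? = λ u → (u ∈? vertices G) ×-dec Q? u
  ; edge?   = λ u v → adj? G u v ×-dec (Q? u ×-dec Q? v)
  ; ends    = λ u v (e , q , _) → adj-∈ˡ G e , q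
  ; flip    = λ u v (e , q , q′) → adj-sym G e , q′ , q
  ; loop    = λ u (e , _) → adj-≢ G e refl
  }

restrict : {Q : Fin m → Set} → (∀ u → Dec (Q u)) → Graph m → Graph m
restrict Q? = build ∘ restrictSpec Q?

module _ {Q : Fin m → Set} (Q? : ∀ u → Dec (Q u)) (G : Graph m) where
  ∈-restrict : ∀ u → u ∈ vertices (restrict Q? G) ⇔ (u ∈ vertices G × Q u)
  ∈-restrict = ∈-build (restrictSpec Q? G)

  adj-restrict : ∀ u v → Adj (restrict Q? G) u v ⇔ (Adj G u v × Q u × Q v)
  adj-restrict = adj-build (restrictSpec Q? G)

  restrict-⊑ : restrict Q? G ⊑ G
  restrict-⊑ = (λ {u} → proj₁ ∘ to (∈-restrict u)) , λ u v → proj₁ ∘ to (adj-restrict u v)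

delete : Fin m → Graph m → Graph m
delete v = restrict λ u → ¬? (u ≟ v)

module _ (v : Fin m) (G : Graph m) where
  ∈-delete : ∀ u → u ∈ vertices (delete v G) ⇔ (u ∈ vertices G × u ≢ v)
  ∈-delete = ∈-restrict (λ u → ¬? (u ≟ v)) G

  adj-delete : ∀ a b → Adj (delete v G) a b ⇔ (Adj G a b × a ≢ v × b ≢ v)
  adj-delete = adj-restrict (λ u → ¬? (u ≟ v)) G

  delete-⊑ : delete v G ⊑ G
  delete-⊑ = restrict-⊑ (λ u → ¬? (u ≟ v)) G

-- The edge uv is dropped when u ≡ v, so that attach is total.
attachSpec : Fin m → Fin m → Graph m → GraphSpec m
attachSpec u v G = record
  { Vertex  = λ w → w ∈ vertices G ⊎ w ≡ u ⊎ w ≡ v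
  ; Edge    = λ a b → Adj G a b ⊎ (a ≢ b × Joins u v a b)
  ; vertex? = λ w → (w ∈? vertices G) ⊎-dec ((w ≟ u) ⊎-dec (w ≟ v))
  ; edge?   = λ a b → adj? G a b ⊎-dec (¬? (a ≟ b) ×-dec
                (((a ≟ u) ×-dec (b ≟ v)) ⊎-dec ((a ≟ v) ×-dec (b ≟ u))))
  ; ends    = λ where
      a b (inj₁ e)                        → inj₁ (adj-∈ˡ G e)
      a b (inj₂ (_ , inj₁ (refl , refl))) → inj₂ (inj₁ refl)
      a b (inj₂ (_ , inj₂ (refl , refl))) → inj₂ (inj₂ refl)
  ; flip    = λ where
      a b (inj₁ e)       → inj₁ (adj-sym G e)
      a b (inj₂ (n , j)) → inj₂ (n ∘ sym , joins-flip j)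
  ; loop    = λ where
      a (inj₁ e)       → adj-≢ G e refl
      a (inj₂ (n , _)) → n refl
  }

attach : Fin m → Fin m → Graph m → Graph m
attach u v G = build (attachSpec u v G)

∈-attach : ∀ (u v : Fin m) G w → w ∈ vertices (attach u v G) ⇔ (w ∈ vertices G ⊎ w ≡ u ⊎ w ≡ v)
∈-attach u v G = ∈-build (attachSpec u v G)

adj-attach : ∀ (u v : Fin m) G a b → Adj (attach u v G) a b ⇔ (Adj G a b ⊎ (a ≢ b × Joins u v a b))
adj-attach u v G = adj-build (attachSpec u v G)

attach-mono : ∀ (u v : Fin m) {G H} → H ⊑ G → attach u v H ⊑ attach u v G
attach-mono u v {G} {H} (V≤ , E≤) =
  (λ {w} p → from (∈-attach u v G w) ([ inj₁ ∘ V≤ , inj₂ ]′ (to (∈-attach u v H w) p))) ,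
  λ a b e → from (adj-attach u v G a b) ([ inj₁ ∘ E≤ a b , inj₂ ]′ (to (adj-attach u v H a b) e))

tree-⊑ : (G H : Graph m) → H ⊑ G → Connected H → Acyclic G → IsTree H
tree-⊑ G H H⊑G conn acyclic = conn , λ (C , C⊑H , isC) → acyclic (C , ⊑-trans C H G C⊑H H⊑G , isC)

single-tree : (v : Fin m) → IsTree (single v)
single-tree v =
  (λ a b a∈ b∈ → case to (∈-single v a) a∈ , to (∈-single v b) b∈ of λ where (refl , refl) → ε) ,
  λ (C , C⊑ , isC) → let k , _ , W = winding {C = C} isC
                         open Winding W
                     in adj-single v (proj₂ C⊑ _ _ (p-edge 0))

-- A walk that enters the leaf `v` has come from `u` and goes back to `u`, so the detour can be cut
-- out.
bypass : (H : Graph m) {u v : Fin m} → (∀ b → Adj H v b → b ≡ u) →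
         ∀ {a b} → Star (Adj H) a b → a ≢ v → b ≢ v → Star (Adj (delete v H)) a b
bypass H leaf ε _ _ = ε
bypass H {v = v} leaf {a} (_◅_ {j = c} e s) a≢ b≢ with c ≟ v
... | no c≢ = from (adj-delete v H a c) (e , a≢ , c≢) ◅ bypass H leaf s c≢ b≢
bypass H leaf (e ◅ ε)       a≢ b≢ | yes refl = ⊥-elim (b≢ refl)
bypass H leaf (e ◅ e′ ◅ s) a≢ b≢ | yes refl
  with refl ← leaf _ (adj-sym H e) | refl ← leaf _ e′ = bypass H leaf s a≢ b≢

delete-connected : (H : Graph m) {u v : Fin m} → (∀ b → Adj H v b → b ≡ u) →
                   Connected H → Connected (delete v H)
delete-connected H {v = v} leaf conn a b a∈ b∈ =
  let a∈H , a≢ = to (∈-delete v H a) a∈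
      b∈H , b≢ = to (∈-delete v H b) b∈
  in bypass H leaf (conn a b a∈H b∈H) a≢ b≢

-- Subtrees after attaching a pendant vertex

IsSubtree : Graph m → Graph m → Set
IsSubtree G H = H ⊑ G × IsTree H

Through : Graph m → Fin m → Graph m → Set
Through G w H = IsSubtree G H × w ∈ vertices H

through? : (G : Graph m) (w : Fin m) (H : Graph m) → Dec (Through G w H)
through? G w H = ((H ⊑? G) ×-dec isTree? H) ×-dec (w ∈? vertices H)

subtree-mono : (G G′ H : Graph m) → G ⊑ G′ → IsSubtree G H → IsSubtree G′ H
subtree-mono G G′ H G⊑ (H⊑ , t) = ⊑-trans H G G′ H⊑ G⊑ , t

module Pendant {u v : Fin m} (G : Graph m) (u∈ : u ∈ vertices G) (v∉ : v ∉ vertices G) where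

  G⁺ : Graph m
  G⁺ = attach u v G

  u≢v : u ≢ v
  u≢v refl = v∉ u∈

  ∈⁺ : ∀ w → w ∈ vertices G⁺ ⇔ (w ∈ vertices G ⊎ w ≡ v)
  ∈⁺ w = mk⇔
    (λ p → case to (∈-attach u v G w) p of λ where
      (inj₁ q)           → inj₁ q
      (inj₂ (inj₁ refl)) → inj₁ u∈
      (inj₂ (inj₂ eq))   → inj₂ eq)
    [ from (∈-attach u v G w) ∘ inj₁ , from (∈-attach u v G w) ∘ inj₂ ∘ inj₂ ]′

  adj⁺ : ∀ a b → Adj G⁺ a b ⇔ (Adj G a b ⊎ Joins u v a b)
  adj⁺ a b = mk⇔
    ([ inj₁ , inj₂ ∘ proj₂ ]′ ∘ to (adj-attach u v G a b))
    λ where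
      (inj₁ e)                      → from (adj-attach u v G a b) (inj₁ e)
      (inj₂ j@(inj₁ (refl , refl))) → from (adj-attach u v G a b) (inj₂ (u≢v , j))
      (inj₂ j@(inj₂ (refl , refl))) → from (adj-attach u v G a b) (inj₂ (u≢v ∘ sym , j))

  v∈⁺ : v ∈ vertices G⁺
  v∈⁺ = from (∈⁺ v) (inj₂ refl)

  ⊑⁺ : G ⊑ G⁺
  ⊑⁺ = (λ {w} → from (∈⁺ w) ∘ inj₁) , λ a b → from (adj⁺ a b) ∘ inj₁

  leaf : ∀ b → Adj G⁺ v b → b ≡ u
  leaf b e with to (adj⁺ v b) e
  ... | inj₁ e′               = ⊥-elim (v∉ (adj-∈ˡ G e′))
  ... | inj₂ (inj₁ (v≡u , _)) = ⊥-elim (u≢v (sym v≡u))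
  ... | inj₂ (inj₂ (_ , eq))  = eq

  ⊑⁻ : (H : Graph m) → H ⊑ G⁺ → v ∉ vertices H → H ⊑ G
  ⊑⁻ H (V≤ , E≤) v∉H =
    (λ {w} p → [ id , (λ where refl → ⊥-elim (v∉H p)) ]′ (to (∈⁺ w) (V≤ p))) ,
    λ a b e → [ id , (λ where
        (inj₁ (refl , refl)) → ⊥-elim (v∉H (adj-∈ʳ H e))
        (inj₂ (refl , refl)) → ⊥-elim (v∉H (adj-∈ˡ H e))) ]′
      (to (adj⁺ a b) (E≤ a b e))

  order⁺ : order G⁺ ≡ suc (order G)
  order⁺ = counts-unique (counts-∈ (vertices G⁺))
    (counts-cong (λ w → mk⇔ (from (∈⁺ w) ∘ swap) (swap ∘ to (∈⁺ w)))
      (counts-⊎ (λ where _ refl → v∉) (counts-one v) (counts-∈ (vertices G))))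

  connected⁺ : Connected G → Connected G⁺
  connected⁺ conn a b a∈ b∈ = case to (∈⁺ a) a∈ , to (∈⁺ b) b∈ of λ where
      (inj₁ p    , inj₁ q)    → inner p q
      (inj₁ p    , inj₂ refl) → inner p u∈ ◅◅ uv ◅ ε
      (inj₂ refl , inj₁ q)    → adj-sym G⁺ uv ◅ inner u∈ q
      (inj₂ refl , inj₂ refl) → ε
    where
    inner : ∀ {a b} → a ∈ vertices G → b ∈ vertices G → Star (Adj G⁺) a b
    inner p q = mapˢ (λ {a} {b} → proj₂ ⊑⁺ a b) (conn _ _ p q)

    uv : Adj G⁺ u v
    uv = from (adj⁺ u v) (inj₂ (inj₁ (refl , refl)))

  -- On a cycle through v, both neighbours of v would be u.
  acyclic⁺ : Acyclic G → Acyclic G⁺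
  acyclic⁺ acyclic (C , C⊑ , isC) = acyclic (C , ⊑⁻ C C⊑ v∉C , isC)
    where
    v∉C : v ∉ vertices C
    v∉C v∈C =
      let k , _ , W = winding {C = C} isC
          open Winding W
          i , v≡   = p-onto v∈C
          j , p≡   = p-previous i
          to-u x e = leaf x (proj₂ C⊑ v x (subst (λ w → Adj C w x) (trans p≡ (sym v≡)) e))
          before   = to-u (p j) (adj-sym C (p-edge j))
          after    = to-u (p (suc (suc j))) (p-edge (suc j))
      in case p-window {j} {2} {0} (s≤s (s≤s (s≤s z≤n))) (s≤s z≤n) (trans after (sym before)) of λ ()

  tree⁺ : IsTree G → IsTree G⁺
  tree⁺ (conn , acyclic) = connected⁺ conn , acyclic⁺ acyclic

module _ {u v : Fin m} (G : Graph m) (u∈ : u ∈ vertices G) (v∉ : v ∉ vertices G) where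
  open Pendant G u∈ v∉

  subtree-without : ∀ H → (IsSubtree G⁺ H × v ∉ vertices H) ⇔ IsSubtree G H
  subtree-without H = mk⇔
    (λ ((H⊑ , t) , v∉H) → ⊑⁻ H H⊑ v∉H , t)
    (λ s@(H⊑ , t) → subtree-mono G G⁺ H ⊑⁺ s , v∉ ∘ proj₁ H⊑)

  attach-subtree : ∀ H → Through G u H → Through G⁺ v (attach u v H)
  attach-subtree H ((H⊑ , t) , u∈H) = (attach-mono u v {G} {H} H⊑ , H⁺.tree⁺ t) , H⁺.v∈⁺
    where module H⁺ = Pendant H u∈H (v∉ ∘ proj₁ H⊑)

  -- `H` lies in `attach u v H′` and avoids `v`, hence lies in `H′`; the converse is symmetric.
  attach-injective : ∀ {H H′} → Through G u H → Through G u H′ →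
                     attach u v H ≡ attach u v H′ → H ≡ H′
  attach-injective {H} {H′} s s′ eq = ⊑-antisym (half H H′ s s′ eq) (half H′ H s′ s (sym eq))
    where
    half : ∀ H H′ → Through G u H → Through G u H′ → attach u v H ≡ attach u v H′ → H ⊑ H′
    half H H′ ((H⊑ , _) , u∈H) ((H′⊑ , _) , u∈H′) eq =
      Pendant.⊑⁻ H′ u∈H′ (v∉ ∘ proj₁ H′⊑) H
        (subst (H ⊑_) eq (Pendant.⊑⁺ H u∈H (v∉ ∘ proj₁ H⊑))) (v∉ ∘ proj₁ H⊑)

  -- If `H` lacks the edge `uv`, then `v` has no neighbour in `H` and, by connectedness, is all of
  -- `H`. Otherwise `v` is a leaf of `H`, and deleting it leaves a tree through `u`.
  subtree-with : ∀ H → Through G⁺ v H →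
                 H ≡ single v ⊎ ∃ λ H′ → Through G u H′ × H ≡ attach u v H′
  subtree-with H ((H⊑ , t@(conn , acyclic)) , v∈H) = case adj? H v u of λ where
      (no ¬e)  → inj₁ (isolated ¬e)
      (yes e) → let u∈D = from (∈-delete v H u) (adj-∈ʳ H e , u≢v)
                    s   = (⊑⁻ D (⊑-trans D H G⁺ D⊑ H⊑) v∉D ,
                           tree-⊑ H D D⊑ (delete-connected H leafᴴ conn) acyclic) , u∈D
                in inj₂ (D , s , restore e u∈D)
    where
    D : Graph _
    D = delete v H

    D⊑ : D ⊑ H
    D⊑ = delete-⊑ v H

    v∉D : v ∉ vertices D
    v∉D p = proj₂ (to (∈-delete v H v) p) refl

    leafᴴ : ∀ b → Adj H v b → b ≡ u
    leafᴴ b = leaf b ∘ proj₂ H⊑ v b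

    isolated : ¬ Adj H v u → H ≡ single v
    isolated ¬e = graph-ext
      (λ w → mk⇔ (from (∈-single v w) ∘ only w) (λ p → subst (_∈ vertices H) (sym (to (∈-single v w) p)) v∈H))
      (λ a b → mk⇔ (λ e → ⊥-elim (none (subst (λ w → Adj H w b) (only a (adj-∈ˡ H e)) e))) (⊥-elim ∘ adj-single v))
      where
      none : ∀ {b} → ¬ Adj H v b
      none e = ¬e (subst (Adj H v) (leafᴴ _ e) e)

      only : ∀ w → w ∈ vertices H → w ≡ v
      only w w∈ with conn v w v∈H w∈
      ... | ε     = refl
      ... | e ◅ _ = ⊥-elim (none e)

    restore : Adj H v u → u ∈ vertices D → H ≡ attach u v D
    restore e u∈D = graph-ext
      (λ w → mk⇔
        (λ w∈ → from (D⁺.∈⁺ w) (case w ≟ v of λ where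
          (yes eq) → inj₂ eq
          (no w≢)  → inj₁ (from (∈-delete v H w) (w∈ , w≢))))
        ([ proj₁ D⊑ , (λ where refl → v∈H) ]′ ∘ to (D⁺.∈⁺ w)))
      (λ a b → mk⇔
        (λ eᵃ → from (D⁺.adj⁺ a b) (case (a ≟ v) , (b ≟ v) of λ where
          (yes refl , _)        → inj₂ (inj₂ (refl , leafᴴ b eᵃ))
          (no a≢    , yes refl) → inj₂ (inj₁ (leafᴴ a (adj-sym H eᵃ) , refl))
          (no a≢    , no b≢)    → inj₁ (from (adj-delete v H a b) (eᵃ , a≢ , b≢))))
        ([ proj₂ D⊑ a b , (λ where
            (inj₁ (refl , refl)) → adj-sym H e
            (inj₂ (refl , refl)) → e) ]′ ∘ to (D⁺.adj⁺ a b)))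
      where module D⁺ = Pendant D u∈D v∉D

  private
    attached-has-v : ∀ H′ → v ∈ vertices (attach u v H′)
    attached-has-v H′ = from (∈-attach u v H′ v) (inj₂ (inj₂ refl))

    v∈single : v ∈ vertices (single v)
    v∈single = from (∈-single v v) refl

    single-subtree : Through G⁺ v (single v)
    single-subtree = (((λ {w} p → subst (_∈ vertices G⁺) (sym (to (∈-single v w) p)) v∈⁺) ,
                       λ _ _ e → ⊥-elim (adj-single v e)) , single-tree v) , v∈single

  through-leaf : ∀ {y} → Counts (Through G u) y → Counts (Through G⁺ v) (suc y)
  through-leaf cy = counts-cong
    (λ H → mk⇔
      (λ where
        (inj₁ refl)            → single-subtree
        (inj₂ (H′ , s , refl)) → attach-subtree H′ s)
      (subtree-with H))
    (counts-⊎
      (λ where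
        _ refl (H′ , (_ , u∈H′) , eq) → u≢v (to (∈-single v u)
          (subst (λ K → u ∈ vertices K) (sym eq) (from (∈-attach u v H′ u) (inj₁ u∈H′)))))
      (counts-one (single v))
      (counts-image (attach u v) attach-injective cy))

  subtrees-attach : ∀ {x y} → Counts (IsSubtree G) x → Counts (Through G u) y →
                    Counts (IsSubtree G⁺) (x + suc y)
  subtrees-attach cx cy = counts-cong
    (λ H → mk⇔ [ proj₁ , proj₁ ]′
      (λ s → case v ∈? vertices H of λ where
        (yes v∈H) → inj₂ (s , v∈H)
        (no v∉H)  → inj₁ (s , v∉H)))
    (counts-⊎ (λ H (_ , v∉H) (_ , v∈H) → v∉H v∈H)
      (counts-cong (λ H → mk⇔ (from (subtree-without H)) (to (subtree-without H))) cx)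
      (through-leaf cy))

  -- A subtree through `v` and `w` is not `single v`, because `w` lies in `G`. So it comes from a
  -- subtree through `u` that already contains `w`.
  through-attach : ∀ {w x y} → w ∈ vertices G → Counts (Through G w) x →
                   Counts (λ H → Through G u H × w ∈ vertices H) y →
                   Counts (Through G⁺ w) (x + y)
  through-attach {w} w∈ cx cy = counts-cong
    (λ H → mk⇔
      (λ where
        (inj₁ ((s , _) , w∈H))            → s , w∈H
        (inj₂ (H′ , (s , w∈H′) , refl)) →
          proj₁ (attach-subtree H′ s) , from (∈-attach u v H′ w) (inj₁ w∈H′))
      (λ (s , w∈H) → case v ∈? vertices H of λ where
        (no v∉H)  → inj₁ ((s , v∉H) , w∈H)
        (yes v∈H) → case subtree-with H (s , v∈H) of λ where
          (inj₁ refl) → ⊥-elim (w≢v (to (∈-single v w) w∈H))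
          (inj₂ (H′ , s′@(_ , u∈H′) , refl)) → inj₂ (H′ , (s′ ,
            ([ id , [ (λ where refl → u∈H′) , ⊥-elim ∘ w≢v ]′ ]′ (to (∈-attach u v H′ w) w∈H))) , refl)))
    (counts-⊎
      (λ where H ((_ , v∉H) , _) (H′ , _ , refl) → v∉H (attached-has-v H′))
      (counts-cong (λ H → mk⇔ (λ (s , w∈H) → from (subtree-without H) s , w∈H)
                              (λ (s , w∈H) → to (subtree-without H) s , w∈H)) cx)
      (counts-image (attach u v) (λ (s , _) (s′ , _) → attach-injective s s′) cy))
    where
    w≢v : w ≢ v
    w≢v refl = v∉ w∈

-- Arcs as the subtrees of a cycle

triangular : ℕ → ℕ
triangular zero    = 0
triangular (suc n) = triangular n + suc n

-- Index set of all arcs: `i` is the start and `j` the number of edges.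
counts-rectangle : ∀ a b → Counts (λ ((i , j) : ℕ × ℕ) → i < a × j < b) (a * b)
counts-rectangle zero    b = counts-none λ _ ()
counts-rectangle (suc a) b = counts-cong
  (λ (i , j) → mk⇔
    (λ where
      (inj₁ (j , j< , refl)) → ℕ.≤-refl , j<
      (inj₂ (i< , j<))       → ℕ.m≤n⇒m≤1+n i< , j<)
    (λ (i< , j<) → case ℕ.m≤n⇒m<n∨m≡n (ℕ.≤-pred i<) of λ where
      (inj₁ i<a)  → inj₂ (i<a , j<)
      (inj₂ refl) → inj₁ (j , j< , refl)))
  (counts-⊎ (λ where _ (_ , _ , refl) (a<a , _) → ℕ.<-irrefl refl a<a)
    (counts-image (a ,_) (λ _ _ → Product.,-injectiveʳ) (counts-< b))
    (counts-rectangle a b))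

-- Index set of the arcs through a fixed vertex: `i` is the offset of that vertex in the arc and `j`
-- the number of edges.
counts-triangle : ∀ a → Counts (λ ((i , j) : ℕ × ℕ) → i ≤ j × j < a) (triangular a)
counts-triangle zero    = counts-none λ _ ()
counts-triangle (suc a) = counts-cong
  (λ (i , j) → mk⇔
    (λ where
      (inj₁ (i≤ , j<))               → i≤ , ℕ.m≤n⇒m≤1+n j<
      (inj₂ (i , s≤s i≤ , refl))     → i≤ , ℕ.≤-refl)
    (λ (i≤ , j<) → case ℕ.m≤n⇒m<n∨m≡n (ℕ.≤-pred j<) of λ where
      (inj₁ j<a)  → inj₁ (i≤ , j<a)
      (inj₂ refl) → inj₂ (i , s≤s i≤ , refl)))
  (counts-⊎ (λ where _ (_ , a<a) (_ , _ , refl) → ℕ.<-irrefl refl a<a)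
    (counts-triangle a)
    (counts-image (_, a) (λ _ _ → Product.,-injectiveˡ) (counts-< (suc a))))

module Arcs {C : Graph m} {k : ℕ} (W : Winding C k) where
  open Winding W

  private
    c = 3 + k

  -- The path p s, p (s + 1), …, p (s + l) with l edges.
  arc : ℕ → ℕ → Graph m
  arc s zero    = single (p s)
  arc s (suc l) = attach (p (suc s)) (p s) (arc (suc s) l)

  ∈-arc⁻ : ∀ {s} l {w} → w ∈ vertices (arc s l) → ∃ λ t → t ≤ l × w ≡ p (t + s)
  ∈-arc⁻ {s} zero    {w} w∈ = 0 , z≤n , to (∈-single (p s) w) w∈
  ∈-arc⁻ {s} (suc l) {w} w∈ with to (∈-attach _ _ (arc (suc s) l) w) w∈
  ... | inj₂ (inj₁ eq) = 1 , s≤s z≤n , eq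
  ... | inj₂ (inj₂ eq) = 0 , z≤n , eq
  ... | inj₁ w∈′       = let t , t≤ , eq = ∈-arc⁻ l w∈′ in
    suc t , s≤s t≤ , trans eq (cong p (ℕ.+-suc t s))

  ∈-arc⁺ : ∀ {s} l {t} → t ≤ l → p (t + s) ∈ vertices (arc s l)
  ∈-arc⁺ {s} zero    {zero}  _        = from (∈-single (p s) (p s)) refl
  ∈-arc⁺ {s} (suc l) {zero}  _        = from (∈-attach _ _ (arc (suc s) l) _) (inj₂ (inj₂ refl))
  ∈-arc⁺ {s} (suc l) {suc t} (s≤s t≤) = from (∈-attach _ _ (arc (suc s) l) _)
    (inj₁ (subst (λ i → p i ∈ vertices (arc (suc s) l)) (ℕ.+-suc t s) (∈-arc⁺ l t≤)))

  adj-arc⁻ : ∀ {s} l {a b} → Adj (arc s l) a b → ∃ λ t → t < l × Joins (p (t + s)) (p (suc t + s)) a b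
  adj-arc⁻ {s} zero            e = ⊥-elim (adj-single (p s) e)
  adj-arc⁻ {s} (suc l) {a} {b} e with to (adj-attach _ _ (arc (suc s) l) a b) e
  ... | inj₂ (_ , j) = 0 , s≤s z≤n , swap j
  ... | inj₁ e′      = let t , t< , j = adj-arc⁻ l e′ in
    suc t , s≤s t< , subst₂ (λ x y → Joins x y a b) (cong p (ℕ.+-suc t s)) (cong (p ∘ suc) (ℕ.+-suc t s)) j

  adj-arc⁺ : ∀ {s} l {t} → t < l → Adj (arc s l) (p (t + s)) (p (suc t + s))
  adj-arc⁺ {s} (suc l) {zero}  _        = from (adj-attach _ _ (arc (suc s) l) _ _)
    (inj₂ (adj-≢ C (p-edge s) , inj₂ (refl , refl)))
  adj-arc⁺ {s} (suc l) {suc t} (s≤s t<) = from (adj-attach _ _ (arc (suc s) l) _ _)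
    (inj₁ (subst (λ i → Adj (arc (suc s) l) (p i) (p (suc i))) (ℕ.+-suc t s) (adj-arc⁺ l t<)))

  joins-adj : ∀ {H : Graph m} {u v a b} → Adj H u v → Joins u v a b → Adj H a b
  joins-adj     e (inj₁ (refl , refl)) = e
  joins-adj {H} e (inj₂ (refl , refl)) = adj-sym H e

  arc-⊑ : ∀ s l → arc s l ⊑ C
  arc-⊑ s l =
    (λ w∈ → let t , _ , eq = ∈-arc⁻ l w∈ in subst (_∈ vertices C) (sym eq) (p-vertex (t + s))) ,
    λ a b e → let t , _ , j = adj-arc⁻ l e in joins-adj {C} (p-edge (t + s)) j

  -- Every step of the recursion attaches a pendant vertex: the rest of the arc occupies offsets
  -- from 1 to the number of edges, all below `c`, and so misses `p s`.
  arc-tree : ∀ s {l} → l < c → IsTree (arc s l)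
  arc-tree s {zero}  _  = single-tree (p s)
  arc-tree s {suc l} l< = Pendant.tree⁺ (arc (suc s) l) (∈-arc⁺ l z≤n)
    (λ ps∈ → let t , t≤ , eq = ∈-arc⁻ l ps∈ in
      case p-window {s} {0} {suc t} (s≤s z≤n) (ℕ.≤-<-trans (s≤s t≤) l<)
        (trans eq (cong p (ℕ.+-suc t s))) of λ ())
    (arc-tree (suc s) (ℕ.<⇒≤ l<))

  arc-cong : ∀ {s s′} l → p s ≡ p s′ → arc s l ≡ arc s′ l
  arc-cong zero    eq = cong single eq
  arc-cong {s} {s′} (suc l) eq
    rewrite arc-cong l (p-suc eq) | p-suc eq | eq = refl

  -- The first vertex of an arc is the one whose predecessor edge is missing.
  arc-start : ∀ {s s′ l l′} → l < c → arc s l ≡ arc s′ l′ → p s ≡ p s′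
  arc-start {s} {s′} {l} {l′} l< eq
    with ∈-arc⁻ l′ (subst (λ H → p s ∈ vertices H) eq (∈-arc⁺ l z≤n))
  ... | zero  , _  , eq′ = eq′
  ... | suc t , t< , ps≡
    with adj-arc⁻ l (subst (λ H → Adj H (p (t + s′)) (p (suc t + s′))) (sym eq) (adj-arc⁺ l′ t<))
  ...   | r , r< , inj₁ (_ , q) = case p-window {s} {0} {suc r} (s≤s z≤n)
            (ℕ.≤-<-trans r< l<) (trans ps≡ q) of λ ()
  -- The two arcs traverse the shared edge in opposite directions. Then `r` is 0 and the vertices
  -- before and after `p s` coincide, which is impossible on a cycle of length at least 3.
  ...   | r , r< , inj₂ (q , q′) with p-window {s} {0} {r} (s≤s z≤n) (ℕ.<-trans r< l<) (trans ps≡ q′)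
  ...     | refl with p-previous s
  ...       | j , pj = case p-window {j} {2} {0} (s≤s (s≤s (s≤s z≤n))) (s≤s z≤n)
              (trans (p-suc pj) (trans (sym q) (p-pred (trans (sym ps≡) (sym pj))))) of λ ()

  -- Once the starts agree, the last vertex of one arc occurs in the other at the same offset, which
  -- bounds the one length by the other.
  arc-length : ∀ {s s′ l l′} → l < c → l′ < c → arc s l ≡ arc s′ l′ → l ≡ l′
  arc-length {s} {s′} {l} {l′} l< l′< eq =
    ℕ.≤-antisym (half l< l′< eq) (half l′< l< (sym eq))
    where
    half : ∀ {s s′ l l′} → l < c → l′ < c → arc s l ≡ arc s′ l′ → l ≤ l′
    half {s} {s′} {l} {l′} l< l′< eq =
      let t , t≤ , eq′ = ∈-arc⁻ l′ (subst (λ H → p (l + s) ∈ vertices H) eq (∈-arc⁺ l ℕ.≤-refl))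
          s≡ = arc-start l< eq
      in subst (_≤ l′) (sym (p-window l< (ℕ.≤-<-trans t≤ l′<)
           (trans eq′ (p-shift t (sym s≡))))) t≤

  private
    edge-in? : (H : Graph m) → ∀ i → Dec (Adj H (p i) (p (suc i)))
    edge-in? H i = adj? H (p i) (p (suc i))

  all-edges : (H : Graph m) → (∀ i → i < c → Adj H (p i) (p (suc i))) → C ⊑ H
  all-edges H edges =
    (λ u∈ → let i , eq = p-onto u∈ in subst (_∈ vertices H) (sym eq) (adj-∈ˡ H (edge i))) ,
    λ a b e → let i , j = to adj-p e in joins-adj {H} (edge i) j
    where
    edge : ∀ i → Adj H (p i) (p (suc i))
    edge i = subst₂ (Adj H) (p-mod i) (p-suc (p-mod i)) (edges (i % c) (m%n<n i c))

  -- The first alternative yields a possible start of an arc: a vertex of `H` whose incoming edge is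
  -- missing.
  backwards : (H : Graph m) → ∀ i → p i ∈ vertices H →
              (∃ λ r → p (suc r) ∈ vertices H × ¬ Adj H (p r) (p (suc r))) ⊎
              (∀ r → r < i → Adj H (p r) (p (suc r)))
  backwards H zero    _  = inj₂ λ _ ()
  backwards H (suc i) p∈ with edge-in? H i
  ... | no ¬e = inj₁ (i , p∈ , ¬e)
  ... | yes e with backwards H i (adj-∈ˡ H e)
  ...   | inj₁ r  = inj₁ r
  ...   | inj₂ es = inj₂ λ r r< → case ℕ.m≤n⇒m<n∨m≡n (ℕ.≤-pred r<) of λ where
            (inj₁ r<i)  → es r r<i
            (inj₂ refl) → e

  -- The first alternative yields the end of an arc: a run of `l` edges of `H` from `p s` that
  -- cannot be prolonged.
  forwards : (H : Graph m) → ∀ s n →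
             (∃ λ l → l < n × (∀ t → t < l → Adj H (p (t + s)) (p (suc t + s))) ×
                      ¬ Adj H (p (l + s)) (p (suc l + s))) ⊎
             (∀ t → t < n → Adj H (p (t + s)) (p (suc t + s)))
  forwards H s zero    = inj₂ λ _ ()
  forwards H s (suc n) with forwards H s n
  ... | inj₁ (l , l< , es , ¬e) = inj₁ (l , ℕ.m≤n⇒m≤1+n l< , es , ¬e)
  ... | inj₂ es with edge-in? H (n + s)
  ...   | no ¬e = inj₁ (n , ℕ.≤-refl , es , ¬e)
  ...   | yes e = inj₂ λ t t< → case ℕ.m≤n⇒m<n∨m≡n (ℕ.≤-pred t<) of λ where
            (inj₁ t<n)  → es t t<n
            (inj₂ refl) → e

  module _ (cycle : IsCycle C) {H : Graph m} (H⊑ : H ⊑ C) (conn : Connected H) where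

    -- Only the two missing edges lead out of the arc, so it is closed under adjacency in `H`. As
    -- `H` is connected and meets the arc, it cannot leave it.
    maximal-arc : ∀ {r l} → p (suc r) ∈ vertices H → ¬ Adj H (p r) (p (suc r)) →
                  (∀ t → t < l → Adj H (p (t + suc r)) (p (suc t + suc r))) →
                  ¬ Adj H (p (l + suc r)) (p (suc l + suc r)) → H ≡ arc (suc r) l
    maximal-arc {r} {l} s∈ ¬before es ¬after = ⊑-antisym
      ((λ {v} → in-arc v) , λ a b e → proj₂ (step a b (in-arc a (adj-∈ˡ H e)) e))
      ((λ w∈ → let t , t≤ , eq = ∈-arc⁻ l w∈ in subst (_∈ vertices H) (sym eq) (inside-H t t≤)) ,
       λ a b e → let t , t< , j = adj-arc⁻ l e in joins-adj {H} (es t t<) j)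
      where
      s = suc r

      inside-H : ∀ t → t ≤ l → p (t + s) ∈ vertices H
      inside-H zero    _  = s∈
      inside-H (suc t) t< = adj-∈ʳ H (es t t<)

      step : ∀ a b → a ∈ vertices (arc s l) → Adj H a b →
             b ∈ vertices (arc s l) × Adj (arc s l) a b
      step a b a∈ e with ∈-arc⁻ l a∈ | to adj-p (proj₂ H⊑ a b e)
      ... | t , t≤ , refl | i , inj₁ (q , q′) with b≡ ← trans q′ (p-suc (sym q)) | ℕ.m≤n⇒m<n∨m≡n t≤
      ...   | inj₁ t<   = subst (λ b → b ∈ vertices (arc s l) × Adj (arc s l) (p (t + s)) b) (sym b≡)
                (adj-∈ʳ (arc s l) (adj-arc⁺ l t<) , adj-arc⁺ l t<)
      ...   | inj₂ refl = ⊥-elim (¬after (subst (Adj H (p (t + s))) b≡ e))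
      step a b a∈ e | zero  , t≤ , refl | i , inj₂ (q , q′) =
        ⊥-elim (¬before (adj-sym H (subst (Adj H (p s)) (trans q′ (p-pred (sym q))) e)))
      step a b a∈ e | suc t , t≤ , refl | i , inj₂ (q , q′) =
        subst (λ b → b ∈ vertices (arc s l) × Adj (arc s l) (p (suc t + s)) b)
          (sym (trans q′ (p-pred (sym q))))
          (adj-∈ˡ (arc s l) (adj-arc⁺ l t≤) , adj-sym (arc s l) (adj-arc⁺ l t≤))

      reach : ∀ {a b} → Star (Adj H) a b → a ∈ vertices (arc s l) → b ∈ vertices (arc s l)
      reach ε        a∈ = a∈
      reach (e ◅ es) a∈ = reach es (proj₁ (step _ _ a∈ e))

      in-arc : ∀ v → v ∈ vertices H → v ∈ vertices (arc s l)
      in-arc v v∈ = reach (conn _ v s∈ v∈) (∈-arc⁺ l z≤n)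

    subtree-arc : Acyclic H → ∀ {w} → w ∈ vertices H → ∃₂ λ s l → l < c × H ≡ arc s l
    subtree-arc acyclic {w} w∈
      with i , w≡ ← p-onto (proj₁ H⊑ w∈)
      -- The walk starts at `c + i` rather than `i`, so that it makes at least one full turn: if it
      -- finds no gap, `H` contains all of `C`.
      with backwards H (c + i) (subst (_∈ vertices H) (trans w≡ (sym (p-period i))) w∈)
    ... | inj₂ es = ⊥-elim (acyclic (C , all-edges H (λ r r< → es r (ℕ.≤-trans r< (ℕ.m≤m+n c i))) , cycle))
    ... | inj₁ (r , s∈ , ¬e) with forwards H (suc r) c
    ...   | inj₁ (l , l< , es , ¬e′) = suc r , l , l< , maximal-arc s∈ ¬e es ¬e′
    -- A run of `c` edges ends with the edge from `p r` to `p (suc r)`, the one known to be missing.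
    ...   | inj₂ es = ⊥-elim (¬e (subst₂ (Adj H) last (p-suc last) (es (2 + k) ℕ.≤-refl)))
      where
      last : p (2 + k + suc r) ≡ p r
      last = trans (cong p (ℕ.+-suc (2 + k) r)) (p-period r)

  module _ (cycle : IsCycle C) where

    emptyGraph : Graph m
    emptyGraph = restrict (λ _ → no id) C

    ∉-empty : ∀ {u} → ¬ u ∈ vertices emptyGraph
    ∉-empty {u} u∈ = proj₂ (to (∈-restrict (λ _ → no id) C u) u∈)

    empty-subtree : IsSubtree C emptyGraph
    empty-subtree = restrict-⊑ (λ _ → no id) C , (λ _ _ u∈ → ⊥-elim (∉-empty u∈)) , λ (D , D⊑ , isD) →
      let k , _ , W = winding {C = D} isD in ∉-empty (proj₁ D⊑ (Winding.p-vertex W 0))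

    subtrees-cycle : Counts (IsSubtree C) (suc (c * c))
    subtrees-cycle = counts-cong
      (λ H → mk⇔
        (λ where
          (inj₁ refl)                        → empty-subtree
          (inj₂ ((s , l) , (_ , l<) , refl)) → arc-⊑ s l , arc-tree s l<)
        (classify H))
      (counts-⊎
        (λ where _ refl ((s , l) , _ , eq) →
                   ∉-empty (subst (λ H → p s ∈ vertices H) (sym eq) (∈-arc⁺ l z≤n)))
        (counts-one emptyGraph)
        (counts-image (uncurry arc)
          (λ (s< , l<) (s′< , l′<) eq →
            cong₂ _,_ (p-inj s< s′< (arc-start l< eq)) (arc-length l< l′< eq))
          (counts-rectangle c c)))
      where
      classify : ∀ H → IsSubtree C H →
                 H ≡ emptyGraph ⊎ ∃ λ ((s , l) : ℕ × ℕ) → (s < c × l < c) × H ≡ arc s l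
      classify H (H⊑ , conn , acyclic) = case nonempty? (vertices H) of λ where
          (yes (w , w∈)) → let s , l , l< , eq = subtree-arc cycle H⊑ conn acyclic w∈ in
            inj₂ ((s % c , l) , (m%n<n s c , l<) , trans eq (arc-cong l (sym (p-mod s))))
          (no ¬ne) → inj₁ (⊑-antisym
            ((λ u∈ → ⊥-elim (¬ne (_ , u∈))) , (λ a b e → ⊥-elim (¬ne (a , adj-∈ˡ H e))))
            ((λ u∈ → ⊥-elim (∉-empty u∈)) , (λ a b e → ⊥-elim (∉-empty (adj-∈ˡ emptyGraph e)))))

    -- The pair `(t , l)` stands for the arc with `l` edges in which `w` has offset `t`.
    through-cycle : ∀ {w} → w ∈ vertices C → Counts (Through C w) (triangular c)
    through-cycle {w} w∈ with p-onto w∈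
    ... | i , refl = counts-cong
      (λ H → mk⇔
        (λ where
          ((t , l) , (t≤ , l<) , refl) →
            (arc-⊑ (start t) l , arc-tree (start t) l<) ,
            subst (_∈ vertices (arc (start t) l)) (start-p (ℕ.≤-trans t≤ (ℕ.<⇒≤ l<))) (∈-arc⁺ l t≤))
        (λ ((H⊑ , conn , acyclic) , w∈H) →
          let s , l , l< , eq = subtree-arc cycle H⊑ conn acyclic w∈H
              t , t≤ , w≡     = ∈-arc⁻ l (subst (λ K → p i ∈ vertices K) eq w∈H)
          in (t , l) , (t≤ , l<) , trans eq (arc-cong l
               (p-cancel t (trans (sym w≡) (sym (start-p (ℕ.≤-trans t≤ (ℕ.<⇒≤ l<)))))))))
      (counts-image (λ (t , l) → arc (start t) l)
        (λ {x} {y} → arcs-distinct x y)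
        (counts-triangle c))
      where
      start : ℕ → ℕ
      -- Going `c ∸ t` steps forward replaces going `t` steps back, so indices stay natural numbers.
      start t = (c ∸ t) + i

      start-p : ∀ {t} → t ≤ c → p (t + start t) ≡ p i
      start-p {t} t≤ = trans
        (cong p (trans (sym (ℕ.+-assoc t (c ∸ t) i)) (cong (_+ i) (ℕ.m+[n∸m]≡n t≤))))
        (p-period i)

      arcs-distinct : ∀ x y → proj₁ x ≤ proj₂ x × proj₂ x < c → proj₁ y ≤ proj₂ y × proj₂ y < c →
                      arc (start (proj₁ x)) (proj₂ x) ≡ arc (start (proj₁ y)) (proj₂ y) → x ≡ y
      arcs-distinct (t , l) (t′ , l′) (t≤ , l<) (t′≤ , l′<) eq = cong₂ _,_
        (p-window (ℕ.≤-<-trans t≤ l<) (ℕ.≤-<-trans t′≤ l′<)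
          (trans (start-p (ℕ.≤-trans t≤ (ℕ.<⇒≤ l<))) (trans (sym (start-p (ℕ.≤-trans t′≤ (ℕ.<⇒≤ l′<))))
            (p-shift t′ (sym (arc-start l< eq))))))
        (arc-length l< l′< eq)

-- Arithmetic of the bounds

-- The values of n(US) and n(UP) on 3 + k vertices.
upper lower : ℕ → ℕ
upper zero    = 10
upper (suc k) = upper k + suc (6 * 2 ^ k)
lower zero    = 10
lower (suc k) = lower k + suc (6 + k)

double-6·2^ : ∀ k → 6 * 2 ^ k + 6 * 2 ^ k ≡ 6 * 2 ^ suc k
double-6·2^ k = eq (2 ^ k)
  where
  eq : ∀ x → 6 * x + 6 * x ≡ 6 * (2 * x)
  eq = solve-∀

suc≤2^ : ∀ k → suc k ≤ 2 ^ k
suc≤2^ zero    = ℕ.≤-refl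
suc≤2^ (suc k) = ℕ.+-mono-≤ (ℕ.m^n>0 2 k) (ℕ.≤-trans (suc≤2^ k) (ℕ.m≤m+n _ 0))

6+2k≤6·2^ : ∀ k → 6 + (k + k) ≤ 6 * 2 ^ k
-- The summand `4 * k` completes the left side to `6 * suc k`, and `suc k ≤ 2 ^ k`.
6+2k≤6·2^ k = ℕ.≤-trans (ℕ.m≤m+n _ (4 * k))
  (ℕ.≤-trans (ℕ.≤-reflexive (eq k)) (ℕ.*-monoʳ-≤ 6 (suc≤2^ k)))
  where
  eq : ∀ k → 6 + (k + k) + 4 * k ≡ 6 * suc k
  eq = solve-∀

-- The increment is written to match those of `lower` and `upper`: `6 + (k + k)` lies between
-- `6 + k` and `6 * 2 ^ k`, so cycles are compared with the bounds one increment at a time.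
square-suc : ∀ k → suc ((4 + k) * (4 + k)) ≡ suc ((3 + k) * (3 + k)) + suc (6 + (k + k))
square-suc = solve-∀

lower≤square : ∀ k → lower k ≤ suc ((3 + k) * (3 + k))
lower≤square zero    = ℕ.≤-refl
lower≤square (suc k) = ℕ.≤-trans
  (ℕ.+-mono-≤ (lower≤square k) (s≤s (ℕ.+-monoʳ-≤ 6 (ℕ.m≤m+n k k))))
  (ℕ.≤-reflexive (sym (square-suc k)))

square≤upper : ∀ k → suc ((3 + k) * (3 + k)) ≤ upper k
square≤upper zero    = ℕ.≤-refl
square≤upper (suc k) = ℕ.≤-trans (ℕ.≤-reflexive (square-suc k))
  (ℕ.+-mono-≤ (square≤upper k) (s≤s (6+2k≤6·2^ k)))

6+k≤triangular : ∀ k → 6 + k ≤ triangular (3 + k)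
6+k≤triangular zero    = ℕ.≤-refl
6+k≤triangular (suc k) = ℕ.≤-trans (ℕ.≤-reflexive (ℕ.+-comm 1 (6 + k)))
  (ℕ.+-mono-≤ (6+k≤triangular k) (s≤s z≤n))

triangular≤6·2^ : ∀ k → triangular (3 + k) ≤ 6 * 2 ^ k
triangular≤6·2^ zero    = ℕ.≤-refl
triangular≤6·2^ (suc k) = ℕ.≤-trans
  (ℕ.+-mono-≤ (triangular≤6·2^ k) (ℕ.≤-trans
    (ℕ.+-mono-≤ {4} {6} (s≤s (s≤s (s≤s (s≤s z≤n)))) (ℕ.m≤m+n k k)) (6+2k≤6·2^ k)))
  (ℕ.≤-reflexive (double-6·2^ k))

-- Bounds for graphs grown from a cycle

-- The index is the order minus 3, not the number of attached vertices, so that cycles of every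
-- length meet the bounds for their own order. The winding is stored to tie its `k` to that index.
data Grown {m} : Graph m → ℕ → Set where
  cycle : ∀ {C k} → IsCycle C → order C ≡ 3 + k → Winding C k → Grown C k
  grow  : ∀ {G k u v} → Grown G k → u ∈ vertices G → v ∉ vertices G → Grown (attach u v G) (suc k)

grown-order : {G : Graph m} {k : ℕ} → Grown G k → order G ≡ 3 + k
grown-order (cycle _ eq _)        = eq
grown-order (grow {G} g u∈ v∉) = trans (Pendant.order⁺ G u∈ v∉) (cong suc (grown-order g))

grown-connected : {G : Graph m} {k : ℕ} → Grown G k → Connected G
grown-connected {G = G} (cycle _ _ W) u v u∈ v∈ =
  let i , u≡ = p-onto u∈
      j , v≡ = p-onto v∈
  in subst (λ u → Star (Adj G) u (p 0)) (sym u≡) (to-0 i) ◅◅ subst (Star (Adj G) (p 0)) (sym v≡) (from-0 j)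
  where
  open Winding W
  to-0 : ∀ i → Star (Adj G) (p i) (p 0)
  to-0 zero    = ε
  to-0 (suc i) = adj-sym G (p-edge i) ◅ to-0 i

  from-0 : ∀ i → Star (Adj G) (p 0) (p i)
  from-0 zero    = ε
  from-0 (suc i) = from-0 i ◅◅ p-edge i ◅ ε
grown-connected (grow {G} g u∈ v∉) = Pendant.connected⁺ G u∈ v∉ (grown-connected g)

-- Supplies a subtree through any two given vertices, which makes the second summand of
-- `through-attach` positive. For a cycle it is the arc with `2 + k` edges, the cycle without one
-- edge.
spanning-tree : {G : Graph m} {k : ℕ} → Grown G k → ∃ λ T → IsSubtree G T × vertices G ⊆ vertices T
spanning-tree {G = G} {k} (cycle _ _ W) = arc 0 (2 + k) , (arc-⊑ 0 (2 + k) , arc-tree 0 ℕ.≤-refl) , λ {w} w∈ →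
  let i , w≡ = p-onto w∈ in
  subst (_∈ vertices (arc 0 (2 + k)))
    (trans (cong p (ℕ.+-identityʳ _)) (trans (p-mod i) (sym w≡)))
    (∈-arc⁺ (2 + k) (ℕ.≤-pred (m%n<n i (3 + k))))
  where
  open Winding W
  open Arcs W
spanning-tree (grow {G} {u = u} {v} g u∈ v∉) with spanning-tree g
... | T , s@(T⊑ , _) , spans = attach u v T , proj₁ (attach-subtree G u∈ v∉ T (s , spans u∈)) ,
  λ {w} w∈ → from (∈-attach u v T w) ([ inj₁ ∘ spans , inj₂ ]′ (to (∈-attach u v G w) w∈))

counts-positive : {P : A → Set} {k : ℕ} (x : A) → P x → Counts P k → 1 ≤ k
counts-positive x px c = counts-mono (λ where _ refl → px) (counts-one x) c

grown-through : {G : Graph m} {k : ℕ} → Grown G k → ∀ {w y} → w ∈ vertices G → Counts (Through G w) y →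
                6 + k ≤ y × y ≤ 6 * 2 ^ k
grown-through (cycle {k = k} isC _ W) w∈ cy with refl ← counts-unique cy (Arcs.through-cycle W isC w∈) =
  6+k≤triangular k , triangular≤6·2^ k
grown-through {m} (grow {G} {k} {u} {v} g u∈ v∉) {w} w∈ cz = case to (Pendant.∈⁺ G u∈ v∉ w) w∈ of λ where
    -- At the new leaf the count is that of `u` plus 1; in the upper bound this 1 is absorbed by the
    -- second copy of `6 * 2 ^ k`.
    (inj₂ refl) → subst Bounds (sym (counts-unique cz (through-leaf G u∈ v∉ cu)))
      (s≤s lo , ℕ.≤-trans (ℕ.+-mono-≤ (ℕ.≤-trans (s≤s z≤n) 6≤) hi) (ℕ.≤-reflexive (double-6·2^ k)))
    (inj₁ w∈G)  →
      let cw = counts-filter (through? G w)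
          c₂ = counts-filter λ H → through? G u H ×-dec (w ∈? vertices H)
          lo′ , hi′ = grown-through g w∈G cw
          T , s , spans = spanning-tree g
      in subst Bounds (sym (counts-unique cz (through-attach G u∈ v∉ w∈G cw c₂)))
        ( ℕ.≤-trans (ℕ.≤-reflexive (ℕ.+-comm 1 (6 + k)))
            (ℕ.+-mono-≤ lo′ (counts-positive T ((s , spans u∈) , spans w∈G) c₂))
        , ℕ.≤-trans (ℕ.+-mono-≤ hi′ (ℕ.≤-trans (counts-mono (λ _ → proj₁) c₂ cu) hi))
            (ℕ.≤-reflexive (double-6·2^ k)))
  where
  cu = counts-filter (through? G u)
  lo = proj₁ (grown-through g u∈ cu)
  hi = proj₂ (grown-through g u∈ cu)

  6≤ : 6 ≤ 6 * 2 ^ k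
  6≤ = ℕ.≤-trans (ℕ.m≤m+n 6 k) (ℕ.≤-trans lo hi)

  Bounds : ℕ → Set
  Bounds y = 6 + suc k ≤ y × y ≤ 6 * 2 ^ suc k

subtree? : (G H : Graph m) → Dec (IsSubtree G H)
subtree? G H = (H ⊑? G) ×-dec isTree? H

grown-bounds : {G : Graph m} {k : ℕ} → Grown G k → ∀ {x} → Counts (IsSubtree G) x → lower k ≤ x × x ≤ upper k
grown-bounds (cycle {k = k} isC _ W) cx with refl ← counts-unique cx (Arcs.subtrees-cycle W isC) =
  lower≤square k , square≤upper k
grown-bounds (grow {G} {k} {u} g u∈ v∉) cz =
  let cx = counts-filter (subtree? G)
      cu = counts-filter (through? G u)
      lo , hi   = grown-bounds g cx
      lo′ , hi′ = grown-through g u∈ cu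
  in subst (λ z → lower (suc k) ≤ z × z ≤ upper (suc k)) (sym (counts-unique cz (subtrees-attach G u∈ v∉ cx cu)))
       (ℕ.+-mono-≤ lo (s≤s lo′) , ℕ.+-mono-≤ hi (s≤s hi′))

-- Unicyclic graphs grow from their cycle

Path : (A → A → Set) → A → List A → A → Set
Path R u []       v = u ≡ v
Path R u (w ∷ ws) v = R u w × Path R w ws v

module _ {R : Fin m → Fin m → Set} where

  path-suffix : ∀ {u w} ws {v} → u ∈ˡ w ∷ ws → Unique (w ∷ ws) → Path R w ws v →
                ∃ λ ws′ → Unique (u ∷ ws′) × Path R u ws′ v
  path-suffix ws       (here refl) ws!       π       = ws , ws! , π
  path-suffix (x ∷ ws) (there u∈)  (_ ∷ ws!) (_ , π) = path-suffix ws u∈ ws! π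

  -- Loop erasure: if `u` recurs on the path found for the rest of the walk, only the part from that
  -- occurrence on is kept.
  simple-path : ∀ {u v} → Star R u v → ∃ λ ws → Unique (u ∷ ws) × Path R u ws v
  simple-path ε = [] , (All.[] ∷ []) , refl
  simple-path {u} (_◅_ {j = w} r s) with simple-path s
  ... | ws , ws! , π with DecMembership._∈?_ _≟_ u (w ∷ ws)
  ...   | yes u∈ = path-suffix ws u∈ ws! π
  ...   | no u∉  = w ∷ ws , All.¬Any⇒All¬ _ u∉ ∷ ws! , r , π

  -- For `z = u` the zip is the one in `CyclicallyConsecutive`: the steps of the path and the
  -- closing pair.
  path-zip : ∀ {u v z} ws → Path R u ws v → ∀ {x y} → (x , y) ∈ˡ zip (u ∷ ws) (ws ∷ʳ z) →
             R x y ⊎ (x ≡ v × y ≡ z)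
  path-zip []       refl    (here refl) = inj₂ (refl , refl)
  path-zip (w ∷ ws) (r , π) (here refl) = inj₁ r
  path-zip (w ∷ ws) (_ , π) (there q)   = path-zip ws π q

  path-closes : ∀ {u v z} ws → Path R u ws v → (v , z) ∈ˡ zip (u ∷ ws) (ws ∷ʳ z)
  path-closes []       refl    = here refl
  path-closes (w ∷ ws) (_ , π) = there (path-closes ws π)

zip-∈ˡ : ∀ {u v : A} xs ys → (u , v) ∈ˡ zip xs ys → u ∈ˡ xs
zip-∈ˡ (x ∷ xs) (y ∷ ys) (here refl) = here refl
zip-∈ˡ (x ∷ xs) (y ∷ ys) (there q)   = there (zip-∈ˡ xs ys q)

zip-∈ʳ : ∀ {u v : A} xs ys → (u , v) ∈ˡ zip xs ys → v ∈ˡ ys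
zip-∈ʳ (x ∷ xs) (y ∷ ys) (here refl) = here refl
zip-∈ʳ (x ∷ xs) (y ∷ ys) (there q)   = there (zip-∈ʳ xs ys q)

∈-rotate : ∀ {x : A} xs → x ∈ˡ rotate xs → x ∈ˡ xs
∈-rotate (y ∷ xs) q = case ∈-++⁻ xs q of λ where
  (inj₁ p)           → there p
  (inj₂ (here refl)) → here refl

cycleSpec : (G : Graph m) (xs : List (Fin m)) → (∀ u v → CyclicallyConsecutive xs u v → Adj G u v) → GraphSpec m
cycleSpec {m} G xs sub = record
  { Vertex  = _∈ˡ xs
  ; Edge    = CyclicallyConsecutive xs
  ; vertex? = λ u → DecMembership._∈?_ _≟_ u xs
  ; edge?   = λ u v → ((u , v) ∈ᵖ? zip xs (rotate xs)) ⊎-dec ((v , u) ∈ᵖ? zip xs (rotate xs))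
  ; ends    = λ u v → [ zip-∈ˡ xs (rotate xs) , ∈-rotate xs ∘ zip-∈ʳ xs (rotate xs) ]′
  ; flip    = λ u v → swap
  ; loop    = λ u e → adj-≢ G (sub u u e) refl
  }
  where
  open DecMembership (Product.≡-dec (_≟_ {m}) (_≟_ {m})) using () renaming (_∈?_ to _∈ᵖ?_)

-- The edge `ab` closes a simple path of `H` from `a` to `b`. The path has at least two edges, since
-- `a` and `b` are distinct and not adjacent in `H`, so the cycle has at least three vertices.
chord-cycle : (H G : Graph m) → H ⊑ G → Connected H → ∀ {a b} → a ∈ vertices H → b ∈ vertices H →
              Adj G a b → ¬ Adj H a b → ∃ λ C → (C ⊑ G × IsCycle C) × Adj C a b
chord-cycle H G (V≤ , E≤) conn {a} {b} a∈ b∈ e ¬e with simple-path (conn a b a∈ b∈)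
... | []         , _ , refl           = ⊥-elim (adj-≢ G e refl)
... | _ ∷ []     , _ , (e′ , refl)    = ⊥-elim (¬e e′)
... | ws@(_ ∷ _ ∷ _) , ws! , π =
  C , (((λ {u} u∈ → vertex u (to (∈-build S u) u∈)) , λ u v e′ → sub u v (to (adj-build S u v) e′)) ,
    (a ∷ ws , ws! , s≤s (s≤s (s≤s z≤n)) , ∈-build S , adj-build S)) ,
  from (adj-build S a b) (inj₂ (path-closes ws π))
  where
  sub₁ : ∀ u v → (u , v) ∈ˡ zip (a ∷ ws) (ws ∷ʳ a) → Adj G u v
  sub₁ u v q = case path-zip ws π q of λ where
    (inj₁ e′)            → E≤ u v e′
    (inj₂ (refl , refl)) → adj-sym G e

  sub : ∀ u v → CyclicallyConsecutive (a ∷ ws) u v → Adj G u v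
  sub u v = [ sub₁ u v , adj-sym G ∘ sub₁ v u ]′

  S = cycleSpec G (a ∷ ws) sub
  C = build S

  path-vertices : ∀ {x y} ws → x ∈ vertices H → Path (Adj H) x ws y → ∀ u → u ∈ˡ x ∷ ws → u ∈ vertices H
  path-vertices ws       x∈ π        u (here refl) = x∈
  path-vertices (w ∷ ws) x∈ (e , π)  u (there u∈)  = path-vertices ws (adj-∈ʳ H e) π u u∈

  vertex : ∀ u → u ∈ˡ a ∷ ws → u ∈ vertices G
  vertex u u∈ = V≤ (path-vertices ws a∈ π u u∈)

crossing-edge : {R : Fin m → Fin m → Set} (V : Subset m) → ∀ {a b} → Star R a b → a ∈ V → b ∉ V →
                ∃₂ λ u v → u ∈ V × v ∉ V × R u v
crossing-edge V ε a∈ b∉ = ⊥-elim (b∉ a∈)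
crossing-edge V (_◅_ {i = a} {j = c} e s) a∈ b∉ with c ∈? V
... | yes c∈ = crossing-edge V s c∈ b∉
... | no c∉  = a , c , a∈ , c∉ , e

module _ (G : Graph m) (conn : Connected G) {C : Graph m} (isC : IsCycle C)
         (C-unique : ∀ {D} → D ⊑ G × IsCycle D → C ≡ D) where

  induced : (H : Graph m) → C ⊑ H → H ⊑ G → Connected H →
            ∀ {a b} → a ∈ vertices H → b ∈ vertices H → Adj G a b → Adj H a b
  induced H C⊑ H⊑ connH {a} {b} a∈ b∈ e = case adj? H a b of λ where
    (yes e′) → e′
    (no ¬e)  → let D , isD , eᴰ = chord-cycle H G H⊑ connH a∈ b∈ e ¬e in
      proj₂ C⊑ a b (subst (λ K → Adj K a b) (sym (C-unique {D} isD)) eᴰ)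

  -- `fuel` bounds the number of vertices of `G` outside `H`. While there are any, a walk to one of
  -- them leaves `H` along some edge, and its far end is attached by this edge alone. That no edge
  -- of `G` is lost in this way follows at the end from `induced`.
  grow-to : ∀ fuel (H : Graph m) {k} → Grown H k → C ⊑ H → H ⊑ G → order G ≤ fuel + order H → ∃ (Grown G)
  grow-to fuel H g C⊑ H⊑ G≤ with Fin.any? (λ v → (v ∈? vertices G) ×-dec ¬? (v ∈? vertices H))
  ... | no ¬out = _ , subst (λ K → Grown K _) (⊑-antisym H⊑ (V≥ , E≥)) g
    where
    V≥ : vertices G ⊆ vertices H
    V≥ {v} v∈ = case v ∈? vertices H of λ where
      (yes v∈H) → v∈H
      (no v∉H)  → ⊥-elim (¬out (v , v∈ , v∉H))

    E≥ : ∀ u v → Adj G u v → Adj H u v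
    E≥ u v e = induced H C⊑ H⊑ (grown-connected g) (V≥ (adj-∈ˡ G e)) (V≥ (adj-∈ʳ G e)) e
  grow-to zero       H g C⊑ H⊑ G≤ | yes (v , v∈ , v∉) =
    ⊥-elim (ℕ.≤⇒≯ G≤ (p⊂q⇒∣p∣<∣q∣ (proj₁ H⊑ , v , v∈ , v∉)))
  grow-to (suc fuel) H g C⊑ H⊑ G≤ | yes (v , v∈ , v∉)
    with _ , _ , W ← winding {C = C} isC
    with c∈ ← proj₁ C⊑ (Winding.p-vertex W 0)
    with u , w , u∈ , w∉ , e ← crossing-edge (vertices H) (conn _ v (proj₁ H⊑ c∈) v∈) c∈ v∉ =
    grow-to fuel H⁺.G⁺ (grow g u∈ w∉) (⊑-trans C H H⁺.G⁺ C⊑ H⁺.⊑⁺) H⁺⊑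
      (ℕ.≤-trans G≤ (ℕ.≤-reflexive (trans (sym (ℕ.+-suc fuel (order H))) (cong (fuel +_) (sym H⁺.order⁺)))))
    where
    module H⁺ = Pendant H u∈ w∉

    H⁺⊑ : H⁺.G⁺ ⊑ G
    H⁺⊑ = (λ {x} x∈ → [ proj₁ H⊑ , (λ where refl → adj-∈ʳ G e) ]′ (to (H⁺.∈⁺ x) x∈)) ,
      λ a b eᵃ → [ proj₂ H⊑ a b , (λ where
        (inj₁ (refl , refl)) → e
        (inj₂ (refl , refl)) → adj-sym G e) ]′ (to (H⁺.adj⁺ a b) eᵃ)

unicyclic⇒grown : (G : Graph m) → Unicyclic G → ∃ (Grown G)
unicyclic⇒grown G (conn , C , (C⊑ , isC) , C-unique) =
  let k , eq , W = winding {C = C} isC in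
  grow-to G conn isC C-unique (order G) C (cycle isC eq W) (id , λ _ _ → id) C⊑ (ℕ.m≤m+n (order G) (order C))

-- The two extremal graphs, grown in the order of their labels

-- The stage of growth on the labels below `n`, kept as a subgraph so that all stages share the type
-- `Graph m`.
initial : ℕ → Graph m → Graph m
initial n = restrict λ u → toℕ u <? n

∈-initial : ∀ n (G : Graph m) u → u ∈ vertices (initial n G) ⇔ (u ∈ vertices G × toℕ u < n)
∈-initial n = ∈-restrict λ u → toℕ u <? n

adj-initial : ∀ n (G : Graph m) u v → Adj (initial n G) u v ⇔ (Adj G u v × toℕ u < n × toℕ v < n)
adj-initial n = adj-restrict λ u → toℕ u <? n

initial-all : (G : Graph m) → initial m G ≡ G
initial-all {m} G = ⊑-antisym (restrict-⊑ (λ u → toℕ u <? m) G)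
  ((λ {u} u∈ → from (∈-initial m G u) (u∈ , Fin.toℕ<n u)) ,
   λ u v e → from (adj-initial m G u v) (e , Fin.toℕ<n u , Fin.toℕ<n v))

module _ (G : Graph m) {u v : Fin m} (u<v : toℕ u < toℕ v) (uv : Adj G u v)
         (only : ∀ w → toℕ w < toℕ v → Adj G w v → w ≡ u) where

  u∈initial : u ∈ vertices (initial (toℕ v) G)
  u∈initial = from (∈-initial _ G u) (adj-∈ˡ G uv , u<v)

  v∉initial : v ∉ vertices (initial (toℕ v) G)
  v∉initial v∈ = ℕ.<-irrefl refl (proj₂ (to (∈-initial _ G v) v∈))

  private
    module G⁺ = Pendant (initial (toℕ v) G) u∈initial v∉initial

    below : ∀ w → toℕ w < suc (toℕ v) → toℕ w < toℕ v ⊎ w ≡ v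
    below w w< = case ℕ.m≤n⇒m<n∨m≡n (ℕ.≤-pred w<) of λ where
      (inj₁ lt) → inj₁ lt
      (inj₂ eq) → inj₂ (Fin.toℕ-injective eq)

  -- By `only`, `v` has no neighbour but `u` among the smaller labels, so it is pendant at the stage
  -- where it appears.
  initial-suc : initial (suc (toℕ v)) G ≡ attach u v (initial (toℕ v) G)
  initial-suc = graph-ext
    (λ w → mk⇔
      (λ w∈ → let w∈G , w< = to (∈-initial _ G w) w∈ in
        from (G⁺.∈⁺ w) ([ (λ lt → inj₁ (from (∈-initial _ G w) (w∈G , lt))) , inj₂ ]′ (below w w<)))
      (λ w∈ → from (∈-initial _ G w) (case to (G⁺.∈⁺ w) w∈ of λ where
        (inj₁ w∈′)  → let w∈G , w< = to (∈-initial _ G w) w∈′ in w∈G , ℕ.m≤n⇒m≤1+n w<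
        (inj₂ refl) → adj-∈ʳ G uv , ℕ.≤-refl)))
    (λ a b → mk⇔
      (λ e → let e′ , a< , b< = to (adj-initial _ G a b) e in
        from (G⁺.adj⁺ a b) (case below a a< , below b b< of λ where
          (inj₁ a<′  , inj₁ b<′)  → inj₁ (from (adj-initial _ G a b) (e′ , a<′ , b<′))
          (inj₁ a<′  , inj₂ refl) → inj₂ (inj₁ (only a a<′ e′ , refl))
          (inj₂ refl , inj₁ b<′)  → inj₂ (inj₂ (refl , only b b<′ (adj-sym G e′)))
          (inj₂ refl , inj₂ refl) → ⊥-elim (adj-≢ G e′ refl)))
      (λ e → from (adj-initial _ G a b) (case to (G⁺.adj⁺ a b) e of λ where
        (inj₁ e′) → let e″ , a< , b< = to (adj-initial _ G a b) e′ in
          e″ , ℕ.m≤n⇒m≤1+n a< , ℕ.m≤n⇒m≤1+n b<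
        (inj₂ (inj₁ (refl , refl))) → uv , ℕ.m≤n⇒m≤1+n u<v , ℕ.≤-refl
        (inj₂ (inj₂ (refl , refl))) → adj-sym G uv , ℕ.≤-refl , ℕ.m≤n⇒m≤1+n u<v)))

pattern #0 = fzero
pattern #1 = fsuc fzero
pattern #2 = fsuc (fsuc fzero)

initial-triangle : (G : Graph (3 + m)) → Adj G #0 #1 → Adj G #1 #2 → Adj G #0 #2 → IsCycle (initial 3 G)
initial-triangle G e₀₁ e₁₂ e₀₂ = #0 ∷ #1 ∷ #2 ∷ [] ,
  (((λ ()) All.∷ (λ ()) All.∷ All.[]) ∷ ((λ ()) All.∷ All.[]) ∷ All.[] ∷ []) ,
  ℕ.≤-refl ,
  (λ u → mk⇔ (λ u∈ → small u (proj₂ (to (∈-initial 3 G u) u∈)))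
    (λ where
      (here refl)                 → from (∈-initial 3 G _) (adj-∈ˡ G e₀₁ , s≤s z≤n)
      (there (here refl))         → from (∈-initial 3 G _) (adj-∈ˡ G e₁₂ , s≤s (s≤s z≤n))
      (there (there (here refl))) → from (∈-initial 3 G _) (adj-∈ʳ G e₁₂ , ℕ.≤-refl))) ,
  λ u v → mk⇔
    (λ e → let e′ , u< , v< = to (adj-initial 3 G u v) e in
      consecutive u v (small u u<) (small v v<) (adj-≢ G e′))
    [ edge u v , adj-sym (initial 3 G) ∘ edge v u ]′
  where
  xs = #0 ∷ #1 ∷ #2 ∷ []

  small : ∀ u → toℕ u < 3 → u ∈ˡ xs
  small #0 _ = here refl
  small #1 _ = there (here refl)
  small #2 _ = there (there (here refl))
  small (fsuc (fsuc (fsuc u))) (s≤s (s≤s (s≤s ())))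

  consecutive : ∀ u v → u ∈ˡ xs → v ∈ˡ xs → u ≢ v → CyclicallyConsecutive xs u v
  consecutive _ _ (here refl)         (here refl)         u≢ = ⊥-elim (u≢ refl)
  consecutive _ _ (here refl)         (there (here refl)) _ = inj₁ (here refl)
  consecutive _ _ (here refl)         (there (there (here refl))) _ = inj₂ (there (there (here refl)))
  consecutive _ _ (there (here refl)) (here refl)         _ = inj₂ (here refl)
  consecutive _ _ (there (here refl)) (there (here refl)) u≢ = ⊥-elim (u≢ refl)
  consecutive _ _ (there (here refl)) (there (there (here refl))) _ = inj₁ (there (here refl))
  consecutive _ _ (there (there (here refl))) (here refl)         _ = inj₁ (there (there (here refl)))
  consecutive _ _ (there (there (here refl))) (there (here refl)) _ = inj₂ (there (here refl))
  consecutive _ _ (there (there (here refl))) (there (there (here refl))) u≢ = ⊥-elim (u≢ refl)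

  edge : ∀ u v → (u , v) ∈ˡ zip xs (rotate xs) → Adj (initial 3 G) u v
  edge _ _ (here refl)                 = from (adj-initial 3 G _ _) (e₀₁ , s≤s z≤n , s≤s (s≤s z≤n))
  edge _ _ (there (here refl))         = from (adj-initial 3 G _ _) (e₁₂ , s≤s (s≤s z≤n) , ℕ.≤-refl)
  edge _ _ (there (there (here refl))) = from (adj-initial 3 G _ _) (adj-sym G e₀₂ , ℕ.≤-refl , s≤s z≤n)

-- The decision procedure repeats the one in `US`, so that both sides refer to the same `table`.
US-adj : ∀ n (u v : Fin n) → Adj (US n) u v ⇔ (USEdge (toℕ u) (toℕ v) ⊎ USEdge (toℕ v) (toℕ u))
US-adj n = ∈-table n {USEdge} λ i j →
  ((i ℕ.≟ 0) ×-dec (0 <? j)) ⊎-dec ((i ℕ.≟ 1) ×-dec (j ℕ.≟ 2))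

UP-adj : ∀ n (u v : Fin n) → Adj (UP n) u v ⇔ (UPEdge (toℕ u) (toℕ v) ⊎ UPEdge (toℕ v) (toℕ u))
UP-adj n = ∈-table n {UPEdge} λ i j →
  ((i <? j) ×-dec (j ≤? 2)) ⊎-dec ((2 ≤? i) ×-dec (j ℕ.≟ suc i))

vertex-at : ∀ {n} k → 4 + k ≤ n → ∃ λ (v : Fin n) → toℕ v ≡ 3 + k
vertex-at k k< = fromℕ< k< , Fin.toℕ-fromℕ< k<

module _ (H : Graph m) {u v : Fin m} (u<v : toℕ u < toℕ v) (uv : Adj H u v)
         (only : ∀ w → toℕ w < toℕ v → Adj H w v → w ≡ u) where
  private
    G  = initial (toℕ v) H
    u∈ = u∈initial H u<v uv only
    v∉ = v∉initial H u<v uv only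
    eq = initial-suc H u<v uv only

  initial-subtrees : ∀ {x y} → Counts (IsSubtree G) x → Counts (Through G u) y →
                     Counts (IsSubtree (initial (suc (toℕ v)) H)) (x + suc y)
  initial-subtrees {x} {y} cx cy = subst (λ G⁺ → Counts (IsSubtree G⁺) (x + suc y)) (sym eq)
    (subtrees-attach G u∈ v∉ cx cy)

  -- The case `w = u` of `through-attach`: the subtrees through both are those through `u`, so the
  -- upper bound's doubling is exact.
  initial-through-u : ∀ {y} → Counts (Through G u) y → Counts (Through (initial (suc (toℕ v)) H) u) (y + y)
  initial-through-u {y} cy = subst (λ G⁺ → Counts (Through G⁺ u) (y + y)) (sym eq)
    (through-attach G u∈ v∉ u∈ cy (counts-cong (λ _ → mk⇔ (λ s → s , proj₂ s) proj₁) cy))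

  initial-through-v : ∀ {y} → Counts (Through G u) y → Counts (Through (initial (suc (toℕ v)) H) v) (suc y)
  initial-through-v {y} cy = subst (λ G⁺ → Counts (Through G⁺ v) (suc y)) (sym eq) (through-leaf G u∈ v∉ cy)

module _ (H : Graph m) (adj : ∀ u v → Adj H u v ⇔ (USEdge (toℕ u) (toℕ v) ⊎ USEdge (toℕ v) (toℕ u)))
         {u : Fin m} (u≡0 : toℕ u ≡ 0) where

  US-growth : ∀ k → 4 + k ≤ m →
              Counts (IsSubtree (initial (3 + k) H)) (upper k) → Counts (Through (initial (3 + k) H) u) (6 * 2 ^ k) →
              Counts (IsSubtree (initial (4 + k) H)) (upper (suc k)) ×
              Counts (Through (initial (4 + k) H) u) (6 * 2 ^ suc k)
  US-growth k k< cx cy with vertex-at k k<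
  -- The label of `v` equals `3 + k` only propositionally; the step is proved at stage `toℕ v`, and
  -- `Result` abstracts the stages for the transport.
  ... | v , v≡ = subst (λ i → Result i (suc i)) v≡ step cx cy
    where
    Result : ℕ → ℕ → Set
    Result i j = Counts (IsSubtree (initial i H)) (upper k) → Counts (Through (initial i H) u) (6 * 2 ^ k) →
                 Counts (IsSubtree (initial j H)) (upper (suc k)) × Counts (Through (initial j H) u) (6 * 2 ^ suc k)

    u<v : toℕ u < toℕ v
    u<v = subst₂ _<_ (sym u≡0) (sym v≡) (s≤s z≤n)

    uv : Adj H u v
    uv = from (adj u v) (inj₁ (inj₁ (u≡0 , subst (0 <_) (sym v≡) (s≤s z≤n))))

    only : ∀ w → toℕ w < toℕ v → Adj H w v → w ≡ u
    only w w<v e = case to (adj w v) e of λ where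
      (inj₁ (inj₁ (w≡0 , _)))  → Fin.toℕ-injective (trans w≡0 (sym u≡0))
      (inj₁ (inj₂ (_ , v≡2)))  → case trans (sym v≡) v≡2 of λ ()
      (inj₂ (inj₁ (v≡0 , _)))  → case trans (sym v≡) v≡0 of λ ()
      (inj₂ (inj₂ (v≡1 , _)))  → case trans (sym v≡) v≡1 of λ ()

    step : Result (toℕ v) (suc (toℕ v))
    step cx cy = initial-subtrees H u<v uv only cx cy ,
      subst (Counts (Through (initial (suc (toℕ v)) H) u)) (double-6·2^ k) (initial-through-u H u<v uv only cy)

module _ (H : Graph m) (adj : ∀ u v → Adj H u v ⇔ (UPEdge (toℕ u) (toℕ v) ⊎ UPEdge (toℕ v) (toℕ u))) where

  -- Unlike the centre of the star, the vertex whose count is tracked moves on: the next point of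
  -- attachment is the leaf `v` just added.
  UP-growth : ∀ k → 4 + k ≤ m → ∀ {u} → toℕ u ≡ 2 + k →
              Counts (IsSubtree (initial (3 + k) H)) (lower k) → Counts (Through (initial (3 + k) H) u) (6 + k) →
              Counts (IsSubtree (initial (4 + k) H)) (lower (suc k)) ×
              ∃ λ v → toℕ v ≡ 3 + k × Counts (Through (initial (4 + k) H) v) (7 + k)
  UP-growth k k< {u} u≡ cx cy with vertex-at k k<
  ... | v , v≡ = let cx⁺ , cy⁺ = subst (λ i → Result i (suc i)) v≡ step cx cy in cx⁺ , v , v≡ , cy⁺
    where
    Result : ℕ → ℕ → Set
    Result i j = Counts (IsSubtree (initial i H)) (lower k) → Counts (Through (initial i H) u) (6 + k) →
                 Counts (IsSubtree (initial j H)) (lower (suc k)) × Counts (Through (initial j H) v) (7 + k)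

    v≡1+u : toℕ v ≡ suc (toℕ u)
    v≡1+u = trans v≡ (cong suc (sym u≡))

    u<v : toℕ u < toℕ v
    u<v = ℕ.≤-reflexive (sym v≡1+u)

    uv : Adj H u v
    uv = from (adj u v) (inj₁ (inj₂ (subst (2 ≤_) (sym u≡) (s≤s (s≤s z≤n)) , v≡1+u)))

    v≰2 : ¬ toℕ v ≤ 2
    v≰2 v≤2 = case subst (_≤ 2) v≡ v≤2 of λ where (s≤s (s≤s ()))

    only : ∀ w → toℕ w < toℕ v → Adj H w v → w ≡ u
    only w w<v e = case to (adj w v) e of λ where
      (inj₁ (inj₁ (_ , v≤2)))   → ⊥-elim (v≰2 v≤2)
      (inj₁ (inj₂ (_ , v≡1+w))) → Fin.toℕ-injective (ℕ.suc-injective (trans (sym v≡1+w) v≡1+u))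
      (inj₂ (inj₁ (v<w , _)))   → ⊥-elim (ℕ.<-asym w<v v<w)
      (inj₂ (inj₂ (_ , w≡1+v))) → ⊥-elim (ℕ.<-asym w<v (ℕ.≤-reflexive (sym w≡1+v)))

    step : Result (toℕ v) (suc (toℕ v))
    step cx cy = initial-subtrees H u<v uv only cx cy , initial-through-v H u<v uv only cy

-- H and its namesake below are US (3 + K) and UP (3 + K); for these concrete graphs
-- conversion checking would unfold the adjacency tables.
module _ {K : ℕ} (H : Graph (3 + K))
         (adj : ∀ u v → Adj H u v ⇔ (USEdge (toℕ u) (toℕ v) ⊎ USEdge (toℕ v) (toℕ u))) where

  US-triangle : IsCycle (initial 3 H)
  US-triangle = initial-triangle H
    (from (adj #0 #1) (inj₁ (inj₁ (refl , s≤s z≤n))))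
    (from (adj #1 #2) (inj₁ (inj₂ (refl , refl))))
    (from (adj #0 #2) (inj₁ (inj₁ (refl , s≤s z≤n))))

  US-counts : ∀ k → 3 + k ≤ 3 + K →
              Counts (IsSubtree (initial (3 + k) H)) (upper k) ×
              Counts (Through (initial (3 + k) H) #0) (6 * 2 ^ k)
  -- The list of the triangle is explicit, so the `k` of its winding reduces to 0 and the counts
  -- compute to 10 and 6.
  US-counts zero    _  = let _ , _ , W = winding {C = initial 3 H} US-triangle in
    Arcs.subtrees-cycle W US-triangle ,
    Arcs.through-cycle W US-triangle (from (∈-initial 3 H #0)
      (adj-∈ˡ H (from (adj #0 #1) (inj₁ (inj₁ (refl , s≤s z≤n)))) , s≤s z≤n))
  US-counts (suc k) k< = let cx , cy = US-counts k (ℕ.<⇒≤ k<) in US-growth H adj refl k k< cx cy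

module _ {K : ℕ} (H : Graph (3 + K))
         (adj : ∀ u v → Adj H u v ⇔ (UPEdge (toℕ u) (toℕ v) ⊎ UPEdge (toℕ v) (toℕ u))) where

  UP-triangle : IsCycle (initial 3 H)
  UP-triangle = initial-triangle H
    (from (adj #0 #1) (inj₁ (inj₁ (s≤s z≤n , s≤s z≤n))))
    (from (adj #1 #2) (inj₁ (inj₁ (ℕ.≤-refl , ℕ.≤-refl))))
    (from (adj #0 #2) (inj₁ (inj₁ (s≤s z≤n , ℕ.≤-refl))))

  UP-counts : ∀ k → 3 + k ≤ 3 + K →
              Counts (IsSubtree (initial (3 + k) H)) (lower k) ×
              ∃ λ u → toℕ u ≡ 2 + k × Counts (Through (initial (3 + k) H) u) (6 + k)
  UP-counts zero    _  = let _ , _ , W = winding {C = initial 3 H} UP-triangle in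
    Arcs.subtrees-cycle W UP-triangle ,
    #2 , refl , Arcs.through-cycle W UP-triangle (from (∈-initial 3 H #2)
      (adj-∈ʳ H (from (adj #1 #2) (inj₁ (inj₁ (ℕ.≤-refl , ℕ.≤-refl)))) , ℕ.≤-refl))
  UP-counts (suc k) k< = let cx , u , u≡ , cy = UP-counts k (ℕ.<⇒≤ k<) in UP-growth H adj k k< u≡ cx cy

-- Extremal values and conclusion

numSubtrees-counts : (G : Graph m) → Counts (IsSubtree G) (numSubtrees G)
numSubtrees-counts G = counts-filter (subtree? G)

numSubtrees-initial : (G : Graph m) → ∀ {x} → Counts (IsSubtree (initial m G)) x → numSubtrees G ≡ x
numSubtrees-initial {m} G {x} cx = counts-unique (numSubtrees-counts G)
  (subst (λ H → Counts (IsSubtree H) x) (initial-all G) cx)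

numSubtrees-US : ∀ k → numSubtrees (US (3 + k)) ≡ upper k
numSubtrees-US k = numSubtrees-initial (US (3 + k))
  (proj₁ (US-counts (US (3 + k)) (US-adj (3 + k)) k ℕ.≤-refl))

numSubtrees-UP : ∀ k → numSubtrees (UP (3 + k)) ≡ lower k
numSubtrees-UP k = numSubtrees-initial (UP (3 + k))
  (proj₁ (UP-counts (UP (3 + k)) (UP-adj (3 + k)) k ℕ.≤-refl))

between : ∀ {n k x} → n ≡ 3 + k → lower k ≤ x → x ≤ upper k →
          (numSubtrees (US n) ≥ x) × (x ≥ numSubtrees (UP n))
between {k = k} {x} refl lo hi =
  subst (x ≤_) (sym (numSubtrees-US k)) hi , subst (_≤ x) (sym (numSubtrees-UP k)) lo

theorem1 : (n : ℕ) → 3 ≤ n → {m : ℕ} (G : Graph m) → order G ≡ n → Unicyclic G → (numSubtrees (US n) ≥ numSubtrees G) × (numSubtrees G ≥ numSubtrees (UP n))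
theorem1 n _ G order≡n unicyclic =
  let k , g   = unicyclic⇒grown G unicyclic
      lo , hi = grown-bounds g (numSubtrees-counts G)
  in between (trans (sym order≡n) (grown-order g)) lo hi
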